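{- For $n\ge 0$, \begin{align*} (\mathfrak C_2+\mathfrak C_2)^n&=\frac{(2n)!}{30}\sum_{l=0}^{n}\frac{(-1)^{n-l}(10n-8l+5)(2n-2l-3)!!}{2^{n-l}(n-l)!\,(2l)!}\mathfrak C_{2l+4}\\ &\quad-\frac{(2n)!}{3}\sum_{l=0}^{n}\frac{(-1)^{n-l}(6l+1)(2n-2l+1)!!}{2^{n-l}(n-l)!\,(2l)!}\mathfrak C_{2l+2}\\ &\quad-\frac{(2n)!}{30}\sum_{l=0}^{n}\frac{(-1)^{n-l}(160l^3-220l^2+72l-1)(2n-2l+1)!!}{2^{n-l}(n-l)!\,(2l)!}\mathfrak C_{2l}. \end{align*}
   Context: The numbers $\mathfrak C_{2n}$ (Cauchy numbers with level $2$) are defined by $\frac{t}{{\rm arcsinh}\,t}=\sum_{n=0}^\infty\mathfrak C_{2n}\frac{t^{2n}}{(2n)!}$. Convolution notation: $(\mathfrak C_{2j_1}+\cdots+\mathfrak C_{2j_k})^n:=\sum_{i_1+\cdots+i_k=n,\ i_1,\dots,i_k\ge0}\frac{(2n)!}{(2i_1)!\cdots(2i_k)!}\mathfrak C_{2i_1+2j_1}\cdots\mathfrak C_{2i_k+2j_k}$. Double factorials: $(2i-1)!!=(2i-1)(2i-3)\cdots1$ for $i\ge1$, $(-1)!!=1$, and $(-(2i+1))!!=\frac{(-1)^i}{(2i-1)!!}$ for $i\ge1$. -}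

module Defs where

open import Data.Fin.Base using (Fin; zero; suc; toℕ)
open import Data.Fin.Properties using (toℕ<n)
open import Data.Integer.Base as ℤ using (ℤ; +_; -[1+_]; 1ℤ; -1ℤ)
open import Data.Nat.Base as ℕ using (ℕ; zero; suc; _∸_; _!; NonZero; z≤n; s≤s)
import Data.Integer.Properties as ℤ
import Data.Nat.Properties as ℕ
open import Data.Rational.Base using (ℚ; 0ℚ; 1ℚ; _+_; _*_; -_; _/_)
import Data.Rational.Base as ℚ
import Data.Rational.Properties as ℚ
import Data.Rational.Unnormalised.Base as ℚᵘ
import Data.Rational.Unnormalised.Properties as ℚᵘ
open import Data.Sum.Base using (_⊎_; inj₁; inj₂)
open import Data.Vec.Base using (Vec; []; _∷_; head; lookup)
open import Function.Base using (_∘_)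
open import Relation.Binary.PropositionalEquality
open import Algebra.Properties.CommutativeMonoid.Sum ℚ.+-0-commutativeMonoid
  using (sum; sum-cong-≗; sum-replicate-zero)

-- The upper limit is included.
sumTo : ℕ → (ℕ → ℚ) → ℚ
sumTo n f = sum {suc n} (λ i → f (toℕ i))

infixl 5 sumTo
syntax sumTo n (λ i → x) = ∑[ i ≤ n ] x

PowerSeries : Set
PowerSeries = ℕ → ℚ

infixl 7 _⊛_
_⊛_ : PowerSeries → PowerSeries → PowerSeries
(f ⊛ g) n = ∑[ i ≤ n ] (f i * g (n ∸ i))

one : PowerSeries
one zero    = 1ℚ
one (suc _) = 0ℚ

-- t · f(t)
shift : PowerSeries → PowerSeries
shift f zero    = 0ℚ
shift f (suc n) = f n

-- the series t
var : PowerSeries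
var = shift one

-- ∑ₙ aₙ t²ⁿ
inSquare : (ℕ → ℚ) → PowerSeries
inSquare a zero          = a 0
inSquare a (suc zero)    = 0ℚ
inSquare a (suc (suc n)) = inSquare (a ∘ suc) n

-- Coefficients b n ∷ … ∷ b 0 of 1 / f, for f with constant term 1:
-- b 0 = 1 and b (n + 1) = - ∑_{i ≤ n} f (i + 1) * b (n - i).
reciprocals : PowerSeries → ∀ n → Vec ℚ (suc n)
reciprocals f zero    = 1ℚ ∷ []
reciprocals f (suc n) =
  - sum (λ (i : Fin (suc n)) → f (suc (toℕ i)) * lookup (reciprocals f n) i)
  ∷ reciprocals f n

reciprocal : PowerSeries → PowerSeries
reciprocal f n = head (reciprocals f n)

-- (arcsinh t) / t = ∑ₙ (-1)ⁿ (2n)! / (4ⁿ n!² (2n+1)) t²ⁿ, by integrating the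
-- binomial series of arcsinh′ t = (1 + t²)^(-1/2).
arcsinh/t : PowerSeries
arcsinh/t = inSquare λ n →
  let instance
        _ = n ℕ.!≢0
        _ = ℕ.m^n≢0 4 n
        _ = ℕ.m*n≢0 (4 ℕ.^ n) (n !)
        _ = ℕ.m*n≢0 (4 ℕ.^ n ℕ.* n !) (n !)
        _ = ℕ.m*n≢0 (4 ℕ.^ n ℕ.* n ! ℕ.* n !) (suc (2 ℕ.* n))
  in (-1ℤ ℤ.^ n ℤ.* + ((2 ℕ.* n) !)) / (4 ℕ.^ n ℕ.* n ! ℕ.* n ! ℕ.* suc (2 ℕ.* n))

arcsinh : PowerSeries
arcsinh = shift arcsinh/t

t/arcsinh : PowerSeries
t/arcsinh = reciprocal arcsinh/t

-- The index is the full subscript, so 𝕮 (2 * n) is the number written 𝕮₂ₙ;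
-- 𝕮 m = 0 for odd m, and t / arcsinh t = ∑ₙ 𝕮₂ₙ t²ⁿ / (2n)! is 𝕮-generating.
𝕮 : ℕ → ℚ
𝕮 m = + (m !) / 1 * t/arcsinh m

-- (𝕮_{2j₁} + 𝕮_{2j₂})ⁿ; the symbolic power is not the power of the sum.
[𝕮₂_+𝕮₂_]^_ : ℕ → ℕ → ℕ → ℚ
[𝕮₂ j₁ +𝕮₂ j₂ ]^ n = ∑[ i ≤ n ]
  ( _/_ (+ ((2 ℕ.* n) !)) ((2 ℕ.* i) ! ℕ.* (2 ℕ.* (n ∸ i)) !) {{(2 ℕ.* i) ℕ.!* (2 ℕ.* (n ∸ i)) !≢0}}
  * 𝕮 (2 ℕ.* i ℕ.+ 2 ℕ.* j₁)
  * 𝕮 (2 ℕ.* (n ∸ i) ℕ.+ 2 ℕ.* j₂) )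

-- (2i - 1)!! = 1 · 3 ⋯ (2i - 1) for natural i
odd‼ : ℕ → ℕ
odd‼ zero    = 1
odd‼ (suc i) = suc (2 ℕ.* i) ℕ.* odd‼ i

odd‼≢0 : ∀ i → NonZero (odd‼ i)
odd‼≢0 zero    = _
odd‼≢0 (suc i) = ℕ.m*n≢0 (suc (2 ℕ.* i)) (odd‼ i) {{_}} {{odd‼≢0 i}}

-- (2i - 1)!! for integer i. At i = -k with k ≥ 1 the argument is -(2k + 1),
-- and the value is (-1)ᵏ / (2k - 1)!!.
[2_-1]‼ : ℤ → ℚ
[2 + i      -1]‼ = + odd‼ i / 1
[2 -[1+ k ] -1]‼ = _/_ (-1ℤ ℤ.^ suc k) (odd‼ (suc k)) {{odd‼≢0 (suc k)}}

-- (-1)^(n-l) / (2^(n-l) (n-l)! (2l)!), for l ≤ n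
weight : ℕ → ℕ → ℚ
weight n l =
  let instance
        _ = ℕ.m^n≢0 2 (n ∸ l)
        _ = (n ∸ l) ℕ.!≢0
        _ = (2 ℕ.* l) ℕ.!≢0
        _ = ℕ.m*n≢0 (2 ℕ.^ (n ∸ l)) ((n ∸ l) !)
        _ = ℕ.m*n≢0 (2 ℕ.^ (n ∸ l) ℕ.* (n ∸ l) !) ((2 ℕ.* l) !)
  in (-1ℤ ℤ.^ (n ∸ l)) / (2 ℕ.^ (n ∸ l) ℕ.* (n ∸ l) ! ℕ.* (2 ℕ.* l) !)

reciprocals-lookup : ∀ f n (i : Fin (suc n)) →
  lookup (reciprocals f n) i ≡ reciprocal f (n ∸ toℕ i)
reciprocals-lookup f zero    zero    = refl
reciprocals-lookup f (suc n) zero    = refl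
reciprocals-lookup f (suc n) (suc i) = reciprocals-lookup f n i

reciprocal-suc : ∀ f n →
  reciprocal f (suc n) ≡ - (∑[ i ≤ n ] (f (suc i) * reciprocal f (n ∸ i)))
reciprocal-suc f n = cong -_ (sum-cong-≗ {suc n} λ i →
  cong (f (suc (toℕ i)) *_) (reciprocals-lookup f n i))

⊛-reciprocal : ∀ f → f 0 ≡ 1ℚ → f ⊛ reciprocal f ≗ one
⊛-reciprocal f f₀ zero    = cong (λ x → x * 1ℚ + 0ℚ) f₀
⊛-reciprocal f f₀ (suc n) = begin
  f 0 * reciprocal f (suc n) + S  ≡⟨ cong₂ (λ x y → x * y + S) f₀ (reciprocal-suc f n) ⟩
  1ℚ * - S + S                    ≡⟨ cong (_+ S) (ℚ.*-identityˡ (- S)) ⟩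
  - S + S                         ≡⟨ ℚ.+-inverseˡ S ⟩
  0ℚ                              ∎
  where
  open ≡-Reasoning
  S = ∑[ i ≤ n ] (f (suc i) * reciprocal f (n ∸ i))

shift-⊛ : ∀ f g → shift f ⊛ g ≗ shift (f ⊛ g)
shift-⊛ f g zero    = trans (ℚ.+-identityʳ _) (ℚ.*-zeroˡ (g 0))
shift-⊛ f g (suc n) =
  trans (cong (_+ (f ⊛ g) n) (ℚ.*-zeroˡ (g (suc n)))) (ℚ.+-identityˡ _)

arcsinh-⊛-t/arcsinh : arcsinh ⊛ t/arcsinh ≗ var
arcsinh-⊛-t/arcsinh zero    = shift-⊛ arcsinh/t t/arcsinh 0
arcsinh-⊛-t/arcsinh (suc n) =
  trans (shift-⊛ arcsinh/t t/arcsinh (suc n)) (⊛-reciprocal arcsinh/t refl n)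

data Odd : ℕ → Set where
  odd-1   : Odd 1
  odd-2+  : ∀ {n} → Odd n → Odd (suc (suc n))

odd-split : ∀ {n} → Odd n → ∀ i → i ℕ.≤ n → Odd i ⊎ Odd (n ∸ i)
odd-split o           zero          _               = inj₂ o
odd-split o           (suc zero)    _               = inj₁ odd-1
odd-split odd-1         (suc (suc i)) (s≤s ())
odd-split (odd-2+ o)  (suc (suc i)) (s≤s (s≤s i≤n)) with odd-split o i i≤n
... | inj₁ p = inj₁ (odd-2+ p)
... | inj₂ q = inj₂ q

inSquare-odd : ∀ a {n} → Odd n → inSquare a n ≡ 0ℚ
inSquare-odd a odd-1      = refl
inSquare-odd a (odd-2+ o) = inSquare-odd (a ∘ suc) o

inSquare-cong : ∀ {a b} → a ≗ b → inSquare a ≗ inSquare b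
inSquare-cong a≗b zero          = a≗b 0
inSquare-cong a≗b (suc zero)    = refl
inSquare-cong a≗b (suc (suc n)) = inSquare-cong (a≗b ∘ suc) n

inSquare-even : ∀ g → (∀ {n} → Odd n → g n ≡ 0ℚ) → inSquare (λ n → g (2 ℕ.* n)) ≗ g
inSquare-even g g-odd zero          = refl
inSquare-even g g-odd (suc zero)    = sym (g-odd odd-1)
inSquare-even g g-odd (suc (suc n)) = trans
  (inSquare-cong (λ k → cong g (ℕ.*-suc 2 k)) n)
  (inSquare-even (λ k → g (suc (suc k))) (λ o → g-odd (odd-2+ o)) n)

reciprocal-odd : ∀ f → (∀ {n} → Odd n → f n ≡ 0ℚ) →
  ∀ b {n} → n ℕ.≤ b → Odd n → reciprocal f n ≡ 0ℚ
reciprocal-odd f f-odd (suc b) {suc n} (s≤s n≤b) o = begin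
  reciprocal f (suc n)                                  ≡⟨ reciprocal-suc f n ⟩
  - (∑[ i ≤ n ] (f (suc i) * reciprocal f (n ∸ i)))     ≡⟨ cong -_ (sum-cong-≗ {suc n} term) ⟩
  - sum {suc n} (λ _ → 0ℚ)                              ≡⟨ cong -_ (sum-replicate-zero (suc n)) ⟩
  0ℚ                                                    ∎
  where
  open ≡-Reasoning
  term : ∀ (i : Fin (suc n)) → f (suc (toℕ i)) * reciprocal f (n ∸ toℕ i) ≡ 0ℚ
  term i with odd-split o (suc (toℕ i)) (toℕ<n i)
  ... | inj₁ p = trans (cong (_* reciprocal f (n ∸ toℕ i)) (f-odd p))
    (ℚ.*-zeroˡ (reciprocal f (n ∸ toℕ i)))
  ... | inj₂ q = trans
    (cong (f (suc (toℕ i)) *_)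
      (reciprocal-odd f f-odd b (ℕ.≤-trans (ℕ.m∸n≤m n (toℕ i)) n≤b) q))
    (ℚ.*-zeroʳ (f (suc (toℕ i))))

t/arcsinh-odd : ∀ {n} → Odd n → t/arcsinh n ≡ 0ℚ
t/arcsinh-odd = reciprocal-odd arcsinh/t (inSquare-odd _) _ ℕ.≤-refl

infix 8 1/_!
1/_! : ℕ → ℚ
1/ n ! = _/_ (+ 1) (n !) {{n ℕ.!≢0}}

d/1*1/d : ∀ d .{{_ : NonZero d}} → (+ d / 1) * (+ 1 / d) ≡ 1ℚ
d/1*1/d d@(suc _) = ℚ.toℚᵘ-injective (begin
  ℚ.toℚᵘ ((+ d / 1) * (+ 1 / d))          ≈⟨ ℚ.toℚᵘ-homo-* (+ d / 1) (+ 1 / d) ⟩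
  ℚ.toℚᵘ (+ d / 1) ℚᵘ.* ℚ.toℚᵘ (+ 1 / d)  ≈⟨ ℚᵘ.*-cong (ℚ.toℚᵘ-fromℚᵘ (+ d ℚᵘ./ 1))
                                                       (ℚ.toℚᵘ-fromℚᵘ (+ 1 ℚᵘ./ d)) ⟩
  (+ d ℚᵘ./ 1) ℚᵘ.* (+ 1 ℚᵘ./ d)          ≈⟨ ℚᵘ.*≡* cross ⟩
  ℚᵘ.1ℚᵘ                                  ∎)
  where
  open ℚᵘ.≃-Reasoning
  cross : + d ℤ.* 1ℤ ℤ.* 1ℤ ≡ 1ℤ ℤ.* + (1 ℕ.* d)
  cross = trans (ℤ.*-identityʳ _) (trans (ℤ.*-identityʳ (+ d))
    (sym (trans (ℤ.*-identityˡ _) (cong +_ (ℕ.*-identityˡ d)))))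

𝕮/! : ∀ m → 𝕮 m * 1/ m ! ≡ t/arcsinh m
𝕮/! m = begin
  a * q * b    ≡⟨ cong (_* b) (ℚ.*-comm a q) ⟩
  q * a * b    ≡⟨ ℚ.*-assoc q a b ⟩
  q * (a * b)  ≡⟨ cong (q *_) (d/1*1/d (m !) {{m ℕ.!≢0}}) ⟩
  q * 1ℚ       ≡⟨ ℚ.*-identityʳ q ⟩
  q            ∎
  where
  open ≡-Reasoning
  a = + (m !) / 1
  b = 1/ m !
  q = t/arcsinh m

𝕮-generating : t/arcsinh ≗ inSquare (λ n → 𝕮 (2 ℕ.* n) * 1/ (2 ℕ.* n) !)
𝕮-generating m = sym (trans
  (inSquare-cong (λ n → 𝕮/! (2 ℕ.* n)) m)
  (inSquare-even t/arcsinh t/arcsinh-odd m))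

{-# OPTIONS --safe #-}

-- Write s = t², θ = t d/dt, v = (1 + s)^(-1/2), w = (1 + s)^(1/2) and G = t / arcsinh t. Then θ v = v³ - v and,
-- since (arcsinh t)′ = v, θ G = G - v G². Hence every D_k = θ (θ - 1) ⋯ (θ - k + 1) G = t^k G⁽ᵏ⁾ is a polynomial in
-- G and v. The theorem is the coefficient of t^(2n+4) in
--   30 D₂² = - (D₄ · 5 θ w + (θ D₄ + D₄) w) - 10 s (3 θ D₂ - 5 D₂) v³ - s² (20 θ³ - 55 θ² + 36 θ - 1) G · v³,
-- which, multiplied by v and reduced by s v² = 1 - v² and v w = 1, is an identity of polynomials in G and v.
module Submission where

open import Algebra.Bundles using (CommutativeRing)
open import Algebra.Solver.Ring.AlmostCommutativeRing using (fromCommutativeRing; _-Raw-AlmostCommutative⟶_)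
import Algebra.Solver.Ring as RingSolver
open import Data.Fin.Base using (Fin; zero; suc; toℕ)
open import Data.Integer.Base as ℤ using (ℤ; +_; 0ℤ; 1ℤ; -1ℤ)
import Data.Integer.Properties as ℤ
open import Data.Maybe.Base using (just; nothing)
open import Data.Nat.Base as ℕ using (ℕ; zero; suc; _∸_; _!; NonZero)
open import Data.Vec.Base using (Vec; []; _∷_; lookup)
open import Level using (_⊔_)
open import Relation.Binary.Definitions using (WeaklyDecidable)
open import Relation.Binary.PropositionalEquality using (cong)
import Relation.Binary.Reasoning.Setoid as SetoidReasoning
open import Relation.Nullary.Decidable using (yes; no)

-- The identity is the theorem read as generating functions. Since θ multiplies the coefficient of
-- t^(2l) by 2l, a polynomial factor in l becomes a polynomial in θ. The numbers 𝕮_(2l+2) / (2l)!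
-- and 𝕮_(2l+4) / (2l)! are the coefficients of D₂ at t^(2l+2) and of D₄ at t^(2l+4). With k = n -
-- l, the fractions (-1)^k (2k+1)!! / (2^k k!) are the coefficients of v³, and those with (2k-3)!!
-- are the coefficients of -w, whence the minus sign before the first term. The factor 30 clears
-- 1/30 and 1/3. A ring solver decides identities between free variables only and knows nothing of θ
-- or of the relations among s, v and w. So θ is computed on the syntax of polynomials in G and v,
-- over any commutative ring with a derivation, and the relations are applied by hand. The relation
-- v w = 1 does not follow from the differential equation of v, which v = 0 satisfies too. It is
-- proved for series, from the constant term and the fact that θ kills only constants.

module IntegerSolver {c ℓ} (R : CommutativeRing c ℓ)
  (hom : ℤ.+-*-rawRing -Raw-AlmostCommutative⟶ fromCommutativeRing R) where
  open CommutativeRing R using (_≈_; reflexive)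
  open _-Raw-AlmostCommutative⟶_ hom

  -- Coefficients are compared as integers because equality in `R` need not be decidable. Distinct
  -- integers may have equal images, so a negative answer says nothing.
  coeff≟ : WeaklyDecidable (λ i j → ⟦ i ⟧ ≈ ⟦ j ⟧)
  coeff≟ i j with i ℤ.≟ j
  ... | yes i≡j = just (reflexive (cong ⟦_⟧ i≡j))
  ... | no  _   = nothing

  open RingSolver ℤ.+-*-rawRing (fromCommutativeRing R) hom coeff≟ public

-- Derivations of commutative rings

record IsDerivation {c ℓ} (R : CommutativeRing c ℓ)
  (hom : ℤ.+-*-rawRing -Raw-AlmostCommutative⟶ fromCommutativeRing R)
  (∂ : CommutativeRing.Carrier R → CommutativeRing.Carrier R) : Set (c ⊔ ℓ) where
  open CommutativeRing R
  open _-Raw-AlmostCommutative⟶_ hom using (⟦_⟧)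
  field
    ∂-cong : ∀ {x y} → x ≈ y → ∂ x ≈ ∂ y
    ∂-+ : ∀ x y → ∂ (x + y) ≈ ∂ x + ∂ y
    ∂-* : ∀ x y → ∂ (x * y) ≈ ∂ x * y + x * ∂ y
    ∂-neg : ∀ x → ∂ (- x) ≈ - ∂ x
    ∂-int : ∀ i → ∂ ⟦ i ⟧ ≈ 0#

module Derivation {c ℓ} (R : CommutativeRing c ℓ)
  (hom : ℤ.+-*-rawRing -Raw-AlmostCommutative⟶ fromCommutativeRing R)
  (∂ : CommutativeRing.Carrier R → CommutativeRing.Carrier R)
  (isDerivation : IsDerivation R hom ∂) where
  open CommutativeRing R hiding (zero)
  open _-Raw-AlmostCommutative⟶_ hom using (0-homo; 1-homo) renaming (⟦_⟧ to int)
  open IsDerivation isDerivation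
  open IntegerSolver R hom
  open SetoidReasoning setoid

  private variable n : ℕ

  -- A derivation is determined on polynomial expressions by its values `δ` on the variables. On
  -- syntax it computes, so iterated derivatives can be handed to the solver.
  derivative : (Fin n → Polynomial n) → Polynomial n → Polynomial n
  derivative δ (op [+] p q)  = derivative δ p :+ derivative δ q
  derivative δ (op [*] p q)  = derivative δ p :* q :+ p :* derivative δ q
  derivative δ (con i)       = con 0ℤ
  derivative δ (var x)       = δ x
  derivative δ (p :^ zero)   = con 0ℤ
  derivative δ (p :^ suc k)  = derivative δ p :* p :^ k :+ p :* derivative δ (p :^ k)
  derivative δ (:- p)        = :- derivative δ p

  derivative-sound : ∀ (δ : Fin n → Polynomial n) ρ → (∀ x → ∂ (lookup ρ x) ≈ ⟦ δ x ⟧ ρ) →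
    ∀ p → ∂ (⟦ p ⟧ ρ) ≈ ⟦ derivative δ p ⟧ ρ
  derivative-sound δ ρ h (op [+] p q) = trans (∂-+ _ _)
    (+-cong (derivative-sound δ ρ h p) (derivative-sound δ ρ h q))
  derivative-sound δ ρ h (op [*] p q) = trans (∂-* _ _)
    (+-cong (*-congʳ (derivative-sound δ ρ h p)) (*-congˡ (derivative-sound δ ρ h q)))
  derivative-sound δ ρ h (con i) = trans (∂-int i) (sym 0-homo)
  derivative-sound δ ρ h (var x) = h x
  derivative-sound δ ρ h (p :^ zero) = trans (∂-cong (sym 1-homo)) (trans (∂-int 1ℤ) (sym 0-homo))
  derivative-sound δ ρ h (p :^ suc k) = trans (∂-* _ _)
    (+-cong (*-congʳ (derivative-sound δ ρ h p)) (*-congˡ (derivative-sound δ ρ h (p :^ k))))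
  derivative-sound δ ρ h (:- p) = trans (∂-neg _) (-‿cong (derivative-sound δ ρ h p))

  -- x ↦ (∂ - 0)(∂ - 1) ⋯ (∂ - (k - 1)) x
  falling : ℕ → Carrier → Carrier
  falling zero    x = x
  falling (suc k) x = ∂ (falling k x) - int (+ k) * falling k x

  fallingₚ : (Fin n → Polynomial n) → ℕ → Polynomial n → Polynomial n
  fallingₚ δ zero    p = p
  fallingₚ δ (suc k) p = derivative δ (fallingₚ δ k p) :- con (+ k) :* fallingₚ δ k p

  falling-sound : ∀ (δ : Fin n → Polynomial n) ρ → (∀ x → ∂ (lookup ρ x) ≈ ⟦ δ x ⟧ ρ) →
    ∀ k p → falling k (⟦ p ⟧ ρ) ≈ ⟦ fallingₚ δ k p ⟧ ρ
  falling-sound δ ρ h zero    p = refl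
  falling-sound δ ρ h (suc k) p = +-cong
    (trans (∂-cong (falling-sound δ ρ h k p)) (derivative-sound δ ρ h (fallingₚ δ k p)))
    (-‿cong (*-congˡ (falling-sound δ ρ h k p)))

  -- On t^(2l) the operator acts as 160 l³ - 220 l² + 72 l - 1, the factor of the third sum.
  cubic : Carrier → Carrier
  cubic x = int (+ 20) * ∂ (∂ (∂ x)) - int (+ 55) * ∂ (∂ x) + int (+ 36) * ∂ x - x

  -- v = (1 + s)^(-1/2)
  module _ {s v : Carrier} (∂s : ∂ s ≈ int (+ 2) * s) (∂v : ∂ v + s * ∂ v ≈ - (s * v)) where

    -- Taking (1 + s) v for the square root of 1 + s avoids a second series: its derivative comes
    -- from that of `v`.
    w : Carrier
    w = v + s * v

    ∂w : ∂ w ≈ s * v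
    ∂w = begin
      ∂ (v + s * v)
        ≈⟨ trans (∂-+ v (s * v)) (+-congˡ (trans (∂-* s v) (+-congʳ (*-congʳ ∂s)))) ⟩
      ∂ v + (int (+ 2) * s * v + s * ∂ v)
        ≈⟨ solve 3 (λ s v v′ → v′ :+ (con (+ 2) :* s :* v :+ s :* v′) := (v′ :+ s :* v′) :+ con (+ 2) :* (s :* v))
             refl s v (∂ v) ⟩
      (∂ v + s * ∂ v) + int (+ 2) * (s * v)
        ≈⟨ +-congʳ ∂v ⟩
      - (s * v) + int (+ 2) * (s * v)
        ≈⟨ solve 1 (λ x → :- x :+ con (+ 2) :* x := x) refl (s * v) ⟩
      s * v
        ∎

    -- This is all that the differential equation gives about v w; the value 1 is an assumption
    -- below and is supplied for series by `v-⊛-w`.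
    ∂[v*w]≈0 : ∂ (v * w) ≈ 0#
    ∂[v*w]≈0 = begin
      ∂ (v * w)
        ≈⟨ trans (∂-* v w) (+-congˡ (*-congˡ ∂w)) ⟩
      ∂ v * w + v * (s * v)
        ≈⟨ solve 3 (λ s v v′ → v′ :* (v :+ s :* v) :+ v :* (s :* v) := v :* ((v′ :+ s :* v′) :+ s :* v))
             refl s v (∂ v) ⟩
      v * ((∂ v + s * ∂ v) + s * v)
        ≈⟨ *-congˡ (trans (+-congʳ ∂v) (-‿inverseˡ (s * v))) ⟩
      v * 0#
        ≈⟨ zeroʳ v ⟩
      0#
        ∎

    module _ (vw : v * w ≈ int 1ℤ) where

      svv : s * (v * v) ≈ int 1ℤ - v * v
      svv = trans (solve 2 (λ s v → s :* (v :* v) := v :* (v :+ s :* v) :- v :* v) refl s v) (+-congʳ vw)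

      -- Since v w = 1 says v² (1 + s) = 1, multiplication by v² replaces division by 1 + s in the
      -- equation (1 + s) ∂v = - s v.
      ∂v-cubic : ∂ v ≈ v * v * v - v
      ∂v-cubic = begin
        ∂ v
          ≈⟨ solve 1 (λ x → x := con 1ℤ :* x) refl (∂ v) ⟩
        int 1ℤ * ∂ v
          ≈⟨ *-congʳ vw ⟨
        v * w * ∂ v
          ≈⟨ solve 3 (λ s v v′ → v :* (v :+ s :* v) :* v′ := v :* v :* (v′ :+ s :* v′)) refl s v (∂ v) ⟩
        v * v * (∂ v + s * ∂ v)
          ≈⟨ *-congˡ ∂v ⟩
        v * v * - (s * v)
          ≈⟨ solve 2 (λ s v → v :* v :* :- (s :* v) := :- (v :* (s :* (v :* v)))) refl s v ⟩
        - (v * (s * (v * v)))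
          ≈⟨ -‿cong (*-congˡ svv) ⟩
        - (v * (int 1ℤ - v * v))
          ≈⟨ solve 1 (λ v → :- (v :* (con 1ℤ :- v :* v)) := v :* v :* v :- v) refl v ⟩
        v * v * v - v
          ∎

  -- Here `a` is arcsinh t / t, and a + θ a is the t-derivative of t a, that is of arcsinh t.
  -- Multiplying the Leibniz rule for G a = 1 by G gives ∂G = - G² ∂a, where ∂a = v - a.
  inverse-derivative : ∀ {G a v} → G * a ≈ int 1ℤ → a + ∂ a ≈ v → ∂ G ≈ G - v * (G * G)
  inverse-derivative {G} {a} {v} Ga a+∂a = begin
    ∂ G
      ≈⟨ solve 1 (λ x → x := con 1ℤ :* x) refl (∂ G) ⟩
    int 1ℤ * ∂ G
      ≈⟨ *-congʳ Ga ⟨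
    G * a * ∂ G
      ≈⟨ solve 4 (λ g a g′ a′ →
             g :* a :* g′ := g :* (g′ :* a :+ g :* a′) :+ g :* a :* g :- (a :+ a′) :* (g :* g))
           refl G a (∂ G) (∂ a) ⟩
    G * (∂ G * a + G * ∂ a) + G * a * G - (a + ∂ a) * (G * G)
      ≈⟨ +-cong (+-cong (*-congˡ (trans (sym (∂-* G a)) (trans (∂-cong Ga) (∂-int 1ℤ)))) (*-congʳ Ga))
           (-‿cong (*-congʳ a+∂a)) ⟩
    G * 0# + int 1ℤ * G - v * (G * G)
      ≈⟨ +-congʳ (trans (+-cong (zeroʳ G) (solve 1 (λ x → con 1ℤ :* x := x) refl G)) (+-identityˡ G)) ⟩
    G - v * (G * G)
      ∎

  -- The identity of polynomials in G and v

  module _ {G v s w : Carrier}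
    (∂G : ∂ G ≈ G - v * (G * G))
    (∂v : ∂ v ≈ v * v * v - v)
    (∂w : ∂ w ≈ s * v)
    (vw : v * w ≈ int 1ℤ)
    (svv : s * (v * v) ≈ int 1ℤ - v * v)
    where

    private
      -- Only G and v become variables: s and w are eliminated before the solver is called, so that
      -- no relation between the variables remains.
      ρ : Vec Carrier 2
      ρ = G ∷ v ∷ []

      Gₚ vₚ : Polynomial 2
      Gₚ = var zero
      vₚ = var (suc zero)

      δ : Fin 2 → Polynomial 2
      δ zero    = Gₚ :- vₚ :* (Gₚ :* Gₚ)
      δ (suc _) = vₚ :* vₚ :* vₚ :- vₚ

      ∂ρ : ∀ x → ∂ (lookup ρ x) ≈ ⟦ δ x ⟧ ρ
      ∂ρ zero       = ∂G
      ∂ρ (suc zero) = ∂v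

      ∂ₚ : Polynomial 2 → Polynomial 2
      ∂ₚ = derivative δ

      Dₚ : ℕ → Polynomial 2
      Dₚ k = fallingₚ δ k Gₚ

      ∂-sound : ∀ {x} p → x ≈ ⟦ p ⟧ ρ → ∂ x ≈ ⟦ ∂ₚ p ⟧ ρ
      ∂-sound p x≈ = trans (∂-cong x≈) (derivative-sound δ ρ ∂ρ p)

      D-sound : ∀ k → falling k G ≈ ⟦ Dₚ k ⟧ ρ
      D-sound k = falling-sound δ ρ ∂ρ k Gₚ

      cubicₚ : Polynomial 2
      cubicₚ = con (+ 20) :* ∂ₚ (∂ₚ (∂ₚ Gₚ)) :- con (+ 55) :* ∂ₚ (∂ₚ Gₚ) :+ con (+ 36) :* ∂ₚ Gₚ :- Gₚ

      cubic-sound : cubic G ≈ ⟦ cubicₚ ⟧ ρ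
      cubic-sound = +-congʳ (+-cong (+-cong
        (*-congˡ (∂-sound (∂ₚ (∂ₚ Gₚ)) (∂-sound (∂ₚ Gₚ) (∂-sound Gₚ refl))))
        (-‿cong (*-congˡ (∂-sound (∂ₚ Gₚ) (∂-sound Gₚ refl)))))
        (*-congˡ (∂-sound Gₚ refl)))

      cancel-v : ∀ {x y} → v * x ≈ v * y → x ≈ y
      cancel-v {x} {y} eq = trans (sym (recover x)) (trans (*-congˡ eq) (recover y))
        where
        recover : ∀ z → w * (v * z) ≈ z
        recover z = trans (solve 3 (λ a b c → a :* (b :* c) := b :* a :* c) refl w v z)
          (trans (*-congʳ vw) (solve 1 (λ a → con 1ℤ :* a := a) refl z))

      -- One factor v suffices to remove s and w from all three terms: v ∂w = s v² = 1 - v² and v w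
      -- = 1 here, then s v⁴ = (1 - v²) v² and s² v⁴ = (1 - v²)² in `second` and `third`.
      first : v * (falling 4 G * (int (+ 5) * ∂ w) + (∂ (falling 4 G) + falling 4 G) * w)
        ≈ ⟦ con (+ 5) :* Dₚ 4 :* (con 1ℤ :- vₚ :* vₚ) :+ (∂ₚ (Dₚ 4) :+ Dₚ 4) ⟧ ρ
      first = begin
        v * (falling 4 G * (int (+ 5) * ∂ w) + (∂ (falling 4 G) + falling 4 G) * w)
          ≈⟨ *-congˡ (+-congʳ (*-congˡ (*-congˡ ∂w))) ⟩
        v * (falling 4 G * (int (+ 5) * (s * v)) + (∂ (falling 4 G) + falling 4 G) * w)
          ≈⟨ solve 5 (λ v s w d e → v :* (d :* (con (+ 5) :* (s :* v)) :+ (e :+ d) :* w)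
               := con (+ 5) :* d :* (s :* (v :* v)) :+ v :* w :* (e :+ d)) refl v s w (falling 4 G) (∂ (falling 4 G)) ⟩
        int (+ 5) * falling 4 G * (s * (v * v)) + v * w * (∂ (falling 4 G) + falling 4 G)
          ≈⟨ +-cong (*-cong (*-congˡ (D-sound 4)) svv)
               (*-cong vw (+-cong (∂-sound (Dₚ 4) (D-sound 4)) (D-sound 4))) ⟩
        int (+ 5) * ⟦ Dₚ 4 ⟧ ρ * (int 1ℤ - v * v) + int 1ℤ * (⟦ ∂ₚ (Dₚ 4) ⟧ ρ + ⟦ Dₚ 4 ⟧ ρ)
          ≈⟨ +-congˡ (solve 1 (λ a → con 1ℤ :* a := a) refl _) ⟩
        ⟦ con (+ 5) :* Dₚ 4 :* (con 1ℤ :- vₚ :* vₚ) :+ (∂ₚ (Dₚ 4) :+ Dₚ 4) ⟧ ρ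
          ∎

      second : v * (s * ((int (+ 3) * ∂ (falling 2 G) - int (+ 5) * falling 2 G) * (v * v * v)))
        ≈ ⟦ (con 1ℤ :- vₚ :* vₚ) :* ((con (+ 3) :* ∂ₚ (Dₚ 2) :- con (+ 5) :* Dₚ 2) :* (vₚ :* vₚ)) ⟧ ρ
      second = trans
        (solve 3 (λ v s d → v :* (s :* (d :* (v :* v :* v))) := s :* (v :* v) :* (d :* (v :* v)))
          refl v s _)
        (*-cong svv (*-congʳ (+-cong (*-congˡ (∂-sound (Dₚ 2) (D-sound 2))) (-‿cong (*-congˡ (D-sound 2))))))

      third : v * (s * (s * (cubic G * (v * v * v))))
        ≈ ⟦ (con 1ℤ :- vₚ :* vₚ) :* ((con 1ℤ :- vₚ :* vₚ) :* cubicₚ) ⟧ ρ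
      third = trans
        (solve 3 (λ v s d → v :* (s :* (s :* (d :* (v :* v :* v)))) := s :* (v :* v) :* (s :* (v :* v) :* d))
          refl v s (cubic G))
        (*-cong svv (*-cong svv cubic-sound))

    convolution-identity :
      int (+ 30) * (falling 2 G * falling 2 G) ≈
        - (falling 4 G * (int (+ 5) * ∂ w) + (∂ (falling 4 G) + falling 4 G) * w)
        - int (+ 10) * (s * ((int (+ 3) * ∂ (falling 2 G) - int (+ 5) * falling 2 G) * (v * v * v)))
        - s * (s * (cubic G * (v * v * v)))
    convolution-identity = cancel-v (begin
      v * (int (+ 30) * (falling 2 G * falling 2 G))
        ≈⟨ *-congˡ (*-congˡ (*-cong (D-sound 2) (D-sound 2))) ⟩
      ⟦ vₚ :* (con (+ 30) :* (Dₚ 2 :* Dₚ 2)) ⟧ ρ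
        -- Both sides now have the same normal form as integer polynomials in two independent
        -- variables.
        ≈⟨ prove ρ (vₚ :* (con (+ 30) :* (Dₚ 2 :* Dₚ 2)))
            ( :- (con (+ 5) :* Dₚ 4 :* (con 1ℤ :- vₚ :* vₚ) :+ (∂ₚ (Dₚ 4) :+ Dₚ 4))
              :- con (+ 10) :* ((con 1ℤ :- vₚ :* vₚ) :* ((con (+ 3) :* ∂ₚ (Dₚ 2) :- con (+ 5) :* Dₚ 2) :* (vₚ :* vₚ)))
              :- ((con 1ℤ :- vₚ :* vₚ) :* ((con 1ℤ :- vₚ :* vₚ) :* cubicₚ))) refl ⟩
      _ ≈⟨ +-cong (+-cong (-‿cong first) (-‿cong (*-congˡ second))) (-‿cong third) ⟨
      _ ≈⟨ solve 4 (λ v a b c → :- (v :* a) :- con (+ 10) :* (v :* b) :- v :* c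
             := v :* (:- a :- con (+ 10) :* b :- c)) refl v _ _ _ ⟩
      v * (- (falling 4 G * (int (+ 5) * ∂ w) + (∂ (falling 4 G) + falling 4 G) * w)
        - int (+ 10) * (s * ((int (+ 3) * ∂ (falling 2 G) - int (+ 5) * falling 2 G) * (v * v * v)))
        - s * (s * (cubic G * (v * v * v)))) ∎)

import Algebra.Construct.Pointwise as Pointwise
open import Data.Fin.Properties using (toℕ<n)
import Data.Nat.Properties as ℕ
import Data.Nat.Tactic.RingSolver as ℕ-Ring
open import Data.Product.Base using (_,_)
open import Data.Rational.Base as ℚ using (ℚ; 0ℚ; 1ℚ; _+_; _-_; _*_; -_; _/_)
import Data.Rational.Properties as ℚ
import Data.Rational.Unnormalised.Base as ℚᵘ
import Data.Rational.Unnormalised.Properties as ℚᵘ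
open import Function.Base using (_∘_)
open import Relation.Binary.PropositionalEquality
open import Algebra.Properties.Semiring.Sum (CommutativeRing.semiring ℚ.+-*-commutativeRing)
  using (sum; sum-cong-≗; ∑-distrib-+; *-distribˡ-sum)
open import Defs

-- Integers as rationals

ι : ℤ → ℚ
ι i = i / 1

-- `_/_` on ℚ reduces by a gcd; unnormalised fractions do not, and there cross-multiplication is
-- enough.
d*[i/d] : ∀ d .{{_ : NonZero d}} i → ι (+ d) * (i / d) ≡ ι i
d*[i/d] d@(suc _) i = ℚ.toℚᵘ-injective (begin
  ℚ.toℚᵘ (ι (+ d) * (i / d))              ≈⟨ ℚ.toℚᵘ-homo-* (ι (+ d)) (i / d) ⟩
  ℚ.toℚᵘ (ι (+ d)) ℚᵘ.* ℚ.toℚᵘ (i / d)    ≈⟨ ℚᵘ.*-cong (ℚ.toℚᵘ-fromℚᵘ (+ d ℚᵘ./ 1)) (ℚ.toℚᵘ-fromℚᵘ (i ℚᵘ./ d)) ⟩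
  (+ d ℚᵘ./ 1) ℚᵘ.* (i ℚᵘ./ d)            ≈⟨ ℚᵘ.*≡* cross ⟩
  i ℚᵘ./ 1                                ≈⟨ ℚ.toℚᵘ-fromℚᵘ (i ℚᵘ./ 1) ⟨
  ℚ.toℚᵘ (ι i)                            ∎)
  where
  open ℚᵘ.≃-Reasoning
  cross : + d ℤ.* i ℤ.* 1ℤ ≡ i ℤ.* + (1 ℕ.* d)
  cross = trans (ℤ.*-identityʳ _) (trans (ℤ.*-comm (+ d) i)
    (cong (λ m → i ℤ.* + m) (sym (ℕ.*-identityˡ d))))

ι-* : ∀ i j → ι (i ℤ.* j) ≡ ι i * ι j
ι-* i j = ℚ.toℚᵘ-injective (begin
  ℚ.toℚᵘ (ι (i ℤ.* j))              ≈⟨ ℚ.toℚᵘ-fromℚᵘ ((i ℤ.* j) ℚᵘ./ 1) ⟩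
  (i ℚᵘ./ 1) ℚᵘ.* (j ℚᵘ./ 1)        ≈⟨ ℚᵘ.*-cong (ℚ.toℚᵘ-fromℚᵘ (i ℚᵘ./ 1)) (ℚ.toℚᵘ-fromℚᵘ (j ℚᵘ./ 1)) ⟨
  ℚ.toℚᵘ (ι i) ℚᵘ.* ℚ.toℚᵘ (ι j)    ≈⟨ ℚ.toℚᵘ-homo-* (ι i) (ι j) ⟨
  ℚ.toℚᵘ (ι i * ι j)                ∎)
  where open ℚᵘ.≃-Reasoning

ι-+ : ∀ i j → ι (i ℤ.+ j) ≡ ι i + ι j
ι-+ i j = ℚ.toℚᵘ-injective (begin
  ℚ.toℚᵘ (ι (i ℤ.+ j))              ≈⟨ ℚ.toℚᵘ-fromℚᵘ ((i ℤ.+ j) ℚᵘ./ 1) ⟩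
  (i ℤ.+ j) ℚᵘ./ 1                  ≈⟨ ℚᵘ.*≡* (cong (ℤ._* 1ℤ) (sym (cong₂ ℤ._+_ (ℤ.*-identityʳ i) (ℤ.*-identityʳ j)))) ⟩
  (i ℚᵘ./ 1) ℚᵘ.+ (j ℚᵘ./ 1)        ≈⟨ ℚᵘ.+-cong (ℚ.toℚᵘ-fromℚᵘ (i ℚᵘ./ 1)) (ℚ.toℚᵘ-fromℚᵘ (j ℚᵘ./ 1)) ⟨
  ℚ.toℚᵘ (ι i) ℚᵘ.+ ℚ.toℚᵘ (ι j)    ≈⟨ ℚ.toℚᵘ-homo-+ (ι i) (ι j) ⟨
  ℚ.toℚᵘ (ι i + ι j)                ∎)
  where open ℚᵘ.≃-Reasoning

ι-neg : ∀ i → ι (ℤ.- i) ≡ - ι i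
ι-neg i = ℚ.toℚᵘ-injective (begin
  ℚ.toℚᵘ (ι (ℤ.- i))    ≈⟨ ℚ.toℚᵘ-fromℚᵘ ((ℤ.- i) ℚᵘ./ 1) ⟩
  ℚᵘ.- (i ℚᵘ./ 1)       ≈⟨ ℚᵘ.-‿cong (ℚ.toℚᵘ-fromℚᵘ (i ℚᵘ./ 1)) ⟨
  ℚᵘ.- ℚ.toℚᵘ (ι i)     ≈⟨ ℚ.toℚᵘ-homo‿- (ι i) ⟨
  ℚ.toℚᵘ (- ι i)        ∎)
  where open ℚᵘ.≃-Reasoning

-- Every formula with a denominator below is proved by multiplying it out and cancelling with this
-- lemma.
ι-cancel : ∀ d .{{_ : NonZero d}} {x y} → ι (+ d) * x ≡ ι (+ d) * y → x ≡ y
ι-cancel d {x} {y} eq = trans (sym (recover x)) (trans (cong (+ 1 / d *_) eq) (recover y))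
  where
  recover : ∀ z → + 1 / d * (ι (+ d) * z) ≡ z
  recover z = trans (sym (ℚ.*-assoc (+ 1 / d) (ι (+ d)) z))
    (trans (cong (_* z) (trans (ℚ.*-comm (+ 1 / d) (ι (+ d))) (d/1*1/d d))) (ℚ.*-identityˡ z))

ι-hom : ℤ.+-*-rawRing -Raw-AlmostCommutative⟶ fromCommutativeRing ℚ.+-*-commutativeRing
ι-hom = record { ⟦_⟧ = ι ; +-homo = ι-+ ; *-homo = ι-* ; -‿homo = ι-neg ; 0-homo = refl ; 1-homo = refl }

module ℚS = IntegerSolver ℚ.+-*-commutativeRing ι-hom

-- The ring of power series

infixl 6 _⊕_
infixl 7 _·_

_⊕_ : PowerSeries → PowerSeries → PowerSeries
(f ⊕ g) n = f n + g n

_·_ : ℚ → PowerSeries → PowerSeries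
(x · f) n = x * f n

⊛-cong : ∀ {f g h k} → f ≗ g → h ≗ k → f ⊛ h ≗ g ⊛ k
⊛-cong f≗g h≗k n = sum-cong-≗ {suc n} λ i → cong₂ _*_ (f≗g (toℕ i)) (h≗k (n ∸ toℕ i))

-- (f ⊛ g) (suc n) unfolds to f 0 * g (suc n) + ((f ∘ suc) ⊛ g) n; this splits off the last summand instead.
⊛-suc : ∀ f g n → (f ⊛ g) (suc n) ≡ (f ⊛ (g ∘ suc)) n + f (suc n) * g 0
⊛-suc f g zero    = solve 2 (λ a b → a :+ (b :+ con 0ℤ) := a :+ con 0ℤ :+ b) refl (f 0 * g 1) (f 1 * g 0)
  where open ℚS
⊛-suc f g (suc n) = trans
  (cong (λ x → f 0 * g (suc (suc n)) + x) (⊛-suc (f ∘ suc) g n))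
  (sym (ℚ.+-assoc (f 0 * g (suc (suc n))) (((f ∘ suc) ⊛ (g ∘ suc)) n) (f (suc (suc n)) * g 0)))

⊛-comm : ∀ f g → f ⊛ g ≗ g ⊛ f
⊛-comm f g zero    = cong (_+ 0ℚ) (ℚ.*-comm (f 0) (g 0))
⊛-comm f g (suc n) = begin
  f 0 * g (suc n) + ((f ∘ suc) ⊛ g) n   ≡⟨ ℚ.+-comm (f 0 * g (suc n)) (((f ∘ suc) ⊛ g) n) ⟩
  ((f ∘ suc) ⊛ g) n + f 0 * g (suc n)   ≡⟨ cong₂ _+_ (⊛-comm (f ∘ suc) g n) (ℚ.*-comm (f 0) (g (suc n))) ⟩
  (g ⊛ (f ∘ suc)) n + g (suc n) * f 0   ≡⟨ ⊛-suc g f n ⟨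
  (g ⊛ f) (suc n)                       ∎
  where open ≡-Reasoning

⊛-distribʳ : ∀ h f g → (f ⊕ g) ⊛ h ≗ (f ⊛ h) ⊕ (g ⊛ h)
⊛-distribʳ h f g n = trans
  (sum-cong-≗ {suc n} λ i → ℚ.*-distribʳ-+ (h (n ∸ toℕ i)) (f (toℕ i)) (g (toℕ i)))
  (∑-distrib-+ {suc n} (λ i → f (toℕ i) * h (n ∸ toℕ i)) (λ i → g (toℕ i) * h (n ∸ toℕ i)))

⊛-distribˡ : ∀ h f g → h ⊛ (f ⊕ g) ≗ (h ⊛ f) ⊕ (h ⊛ g)
⊛-distribˡ h f g n = trans (⊛-comm h (f ⊕ g) n)
  (trans (⊛-distribʳ h f g n) (cong₂ _+_ (⊛-comm f h n) (⊛-comm g h n)))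

·-⊛ : ∀ x f g → (x · f) ⊛ g ≗ x · (f ⊛ g)
·-⊛ x f g n = trans
  (sum-cong-≗ {suc n} λ i → ℚ.*-assoc x (f (toℕ i)) (g (n ∸ toℕ i)))
  (sym (*-distribˡ-sum {suc n} x (λ i → f (toℕ i) * g (n ∸ toℕ i))))

⊛-assoc : ∀ f g h → (f ⊛ g) ⊛ h ≗ f ⊛ (g ⊛ h)
⊛-assoc f g h zero    = solve 3 (λ a b c → (a :* b :+ con 0ℤ) :* c :+ con 0ℤ := a :* (b :* c :+ con 0ℤ) :+ con 0ℤ)
  refl (f 0) (g 0) (h 0)
  where open ℚS
⊛-assoc f g h (suc n) = begin
  (f 0 * g 0 + 0ℚ) * h (suc n) + ((f 0 · g′ ⊕ (f′ ⊛ g)) ⊛ h) n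
    -- The tail of `f ⊛ g` unfolds to `f 0 · g′ ⊕ (f′ ⊛ g)`, so the induction hypothesis is needed
    -- for the tail of `f` with `g` and `h` unchanged.
    ≡⟨ cong (λ x → (f 0 * g 0 + 0ℚ) * h (suc n) + x) (trans (⊛-distribʳ h (f 0 · g′) (f′ ⊛ g) n)
         (cong₂ _+_ (·-⊛ (f 0) g′ h n) (⊛-assoc f′ g h n))) ⟩
  (f 0 * g 0 + 0ℚ) * h (suc n) + (f 0 * (g′ ⊛ h) n + (f′ ⊛ (g ⊛ h)) n)
    ≡⟨ solve 5 (λ a b c d e → (a :* b :+ con 0ℤ) :* c :+ (a :* d :+ e) := a :* (b :* c :+ d) :+ e)
         refl (f 0) (g 0) (h (suc n)) ((g′ ⊛ h) n) ((f′ ⊛ (g ⊛ h)) n) ⟩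
  f 0 * (g 0 * h (suc n) + (g′ ⊛ h) n) + (f′ ⊛ (g ⊛ h)) n
    ∎
  where
  open ≡-Reasoning
  open ℚS using (solve; con; _:+_; _:*_; _:=_)
  f′ = f ∘ suc
  g′ = g ∘ suc

zero-⊛ : ∀ f g → (∀ n → f n ≡ 0ℚ) → ∀ n → (f ⊛ g) n ≡ 0ℚ
zero-⊛ f g f≗0 zero    = trans (cong (λ x → x * g 0 + 0ℚ) (f≗0 0)) (trans (ℚ.+-identityʳ _) (ℚ.*-zeroˡ (g 0)))
zero-⊛ f g f≗0 (suc n) = trans
  (cong₂ (λ x y → x * g (suc n) + y) (f≗0 0) (zero-⊛ (f ∘ suc) g (f≗0 ∘ suc) n))
  (trans (ℚ.+-identityʳ _) (ℚ.*-zeroˡ (g (suc n))))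

one-⊛ : ∀ f → one ⊛ f ≗ f
one-⊛ f zero    = trans (ℚ.+-identityʳ _) (ℚ.*-identityˡ (f 0))
one-⊛ f (suc n) = trans
  (cong₂ _+_ (ℚ.*-identityˡ (f (suc n))) (zero-⊛ (one ∘ suc) f (λ _ → refl) n))
  (ℚ.+-identityʳ (f (suc n)))

seriesRing : CommutativeRing _ _
seriesRing = record
  { Carrier = PowerSeries
  ; _≈_ = _≗_
  ; _+_ = _⊕_
  ; _*_ = _⊛_
  ; -_ = λ f n → - f n
  ; 0# = λ _ → 0ℚ
  ; 1# = one
  ; isCommutativeRing = record
    { isRing = record
      { +-isAbelianGroup = Pointwise.isAbelianGroup ℕ ℚ.+-0-isAbelianGroup
      ; *-cong = ⊛-cong
      ; *-assoc = ⊛-assoc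
      ; *-identity = one-⊛ , λ f n → trans (⊛-comm f one n) (one-⊛ f n)
      ; distrib = ⊛-distribˡ , ⊛-distribʳ
      }
    ; *-comm = ⊛-comm
    }
  }

constant : ℤ → PowerSeries
constant i = ι i · one

constant-⊛ : ∀ i f → constant i ⊛ f ≗ ι i · f
constant-⊛ i f n = trans (·-⊛ (ι i) one f n) (cong (ι i *_) (one-⊛ f n))

constant-hom : ℤ.+-*-rawRing -Raw-AlmostCommutative⟶ fromCommutativeRing seriesRing
constant-hom = record
  { ⟦_⟧ = constant
  ; +-homo = λ i j n → trans (cong (_* one n) (ι-+ i j)) (ℚ.*-distribʳ-+ (one n) (ι i) (ι j))
  ; *-homo = λ i j n → trans (cong (_* one n) (ι-* i j))
      (trans (ℚ.*-assoc (ι i) (ι j) (one n)) (sym (constant-⊛ i (constant j) n)))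
  ; -‿homo = λ i n → trans (cong (_* one n) (ι-neg i)) (sym (ℚ.neg-distribˡ-* (ι i) (one n)))
  ; 0-homo = λ n → ℚ.*-zeroˡ (one n)
  ; 1-homo = λ n → ℚ.*-identityˡ (one n)
  }

-- The derivation θ

double : ℕ → ℚ
double n = ι (+ (2 ℕ.* n))

double-+ : ∀ m n → double (m ℕ.+ n) ≡ double m + double n
double-+ m n = trans (cong (λ k → ι (+ k)) (ℕ.*-distribˡ-+ 2 m n)) (ι-+ (+ (2 ℕ.* m)) (+ (2 ℕ.* n)))

-- t d/dt on series in s = t²
θ : PowerSeries → PowerSeries
θ f n = double n * f n

θ-⊛ : ∀ f g → θ (f ⊛ g) ≗ (θ f ⊛ g) ⊕ (f ⊛ θ g)
θ-⊛ f g n = begin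
  double n * (f ⊛ g) n
    ≡⟨ *-distribˡ-sum {suc n} (double n) (λ i → f (toℕ i) * g (n ∸ toℕ i)) ⟩
  sum {suc n} (λ i → double n * (f (toℕ i) * g (n ∸ toℕ i)))
    ≡⟨ sum-cong-≗ {suc n} (λ i → trans
         (cong (_* (f (toℕ i) * g (n ∸ toℕ i))) (split i))
         (solve 4 (λ a b c d → (a :+ b) :* (c :* d) := a :* c :* d :+ c :* (b :* d)) refl
           (double (toℕ i)) (double (n ∸ toℕ i)) (f (toℕ i)) (g (n ∸ toℕ i)))) ⟩
  sum {suc n} (λ i → θ f (toℕ i) * g (n ∸ toℕ i) + f (toℕ i) * θ g (n ∸ toℕ i))
    ≡⟨ ∑-distrib-+ {suc n} (λ i → θ f (toℕ i) * g (n ∸ toℕ i)) (λ i → f (toℕ i) * θ g (n ∸ toℕ i)) ⟩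
  (θ f ⊛ g) n + (f ⊛ θ g) n
    ∎
  where
  open ≡-Reasoning
  open ℚS using (solve; _:+_; _:*_; _:=_)
  split : ∀ (i : Fin (suc n)) → double n ≡ double (toℕ i) + double (n ∸ toℕ i)
  split i = trans (cong double (sym (ℕ.m+[n∸m]≡n (ℕ.s≤s⁻¹ (toℕ<n i))))) (double-+ (toℕ i) (n ∸ toℕ i))

θ-constant : ∀ i n → θ (constant i) n ≡ 0ℚ
θ-constant i zero    = ℚ.*-zeroˡ (constant i 0)
θ-constant i (suc n) = trans (cong (double (suc n) *_) (ℚ.*-zeroʳ (ι i))) (ℚ.*-zeroʳ (double (suc n)))

-- The series v, w and G

ι-ℕ* : ∀ m n → ι (+ (m ℕ.* n)) ≡ ι (+ m) * ι (+ n)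
ι-ℕ* m n = trans (cong ι (ℤ.pos-* m n)) (ι-* (+ m) (+ n))

double-suc : ∀ n → double (suc n) ≡ ι (+ 2) + double n
double-suc n = double-+ 1 n

ι-suc-2* : ∀ n → ι (+ suc (2 ℕ.* n)) ≡ 1ℚ + double n
ι-suc-2* n = ι-+ 1ℤ (+ (2 ℕ.* n))

-- The double factorial (2n)!!, the common denominator of the coefficients of (1 + s)^(1/2), (1 +
-- s)^(-1/2) and (1 + s)^(-3/2) at sⁿ.
half-power : ℕ → ℕ
half-power n = 2 ℕ.^ n ℕ.* n !

half-power≢0 : ∀ n → NonZero (half-power n)
half-power≢0 n = ℕ.m*n≢0 (2 ℕ.^ n) (n !) {{ℕ.m^n≢0 2 n}} {{n ℕ.!≢0}}

half-power-suc : ∀ n → half-power (suc n) ≡ half-power n ℕ.* (2 ℕ.* suc n)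
half-power-suc n = regroup n (2 ℕ.^ n) (n !)
  where
  regroup : ∀ n a b → 2 ℕ.* a ℕ.* (suc n ℕ.* b) ≡ a ℕ.* b ℕ.* (2 ℕ.* suc n)
  regroup = ℕ-Ring.solve-∀

even! : ∀ n → (2 ℕ.* n) ! ≡ half-power n ℕ.* odd‼ n
even! zero    = refl
even! (suc n) = begin
  (2 ℕ.* suc n) !
    ≡⟨ cong _! (ℕ.*-suc 2 n) ⟩
  suc (suc (2 ℕ.* n)) ℕ.* (suc (2 ℕ.* n) ℕ.* (2 ℕ.* n) !)
    ≡⟨ cong (λ m → suc (suc (2 ℕ.* n)) ℕ.* (suc (2 ℕ.* n) ℕ.* m)) (even! n) ⟩
  suc (suc (2 ℕ.* n)) ℕ.* (suc (2 ℕ.* n) ℕ.* (2 ℕ.^ n ℕ.* n ! ℕ.* odd‼ n))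
    ≡⟨ regroup n (2 ℕ.^ n) (n !) (odd‼ n) ⟩
  half-power (suc n) ℕ.* odd‼ (suc n)
    ∎
  where
  open ≡-Reasoning
  regroup : ∀ n a b c → suc (suc (2 ℕ.* n)) ℕ.* (suc (2 ℕ.* n) ℕ.* (a ℕ.* b ℕ.* c))
    ≡ 2 ℕ.* a ℕ.* (suc n ℕ.* b) ℕ.* (suc (2 ℕ.* n) ℕ.* c)
  regroup = ℕ-Ring.solve-∀

sign : ℕ → ℚ
sign n = ι (-1ℤ ℤ.^ n)

sign-suc : ∀ n → sign (suc n) ≡ - sign n
sign-suc n = trans (ι-* -1ℤ (-1ℤ ℤ.^ n)) (solve 1 (λ x → con -1ℤ :* x := :- x) refl (sign n))
  where open ℚS

-- (1 + t²)^(-1/2)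
v : PowerSeries
v n = _/_ (-1ℤ ℤ.^ n ℤ.* + odd‼ n) (half-power n) {{half-power≢0 n}}

half-power*v : ∀ n → ι (+ half-power n) * v n ≡ sign n * ι (+ odd‼ n)
half-power*v n = trans (d*[i/d] (half-power n) {{half-power≢0 n}} (-1ℤ ℤ.^ n ℤ.* + odd‼ n)) (ι-* (-1ℤ ℤ.^ n) (+ odd‼ n))

-- The ratio of consecutive binomial coefficients with exponent -1/2. Summed over n it is the
-- differential equation `θ-v`.
v-recurrence : ∀ n → double (suc n) * v (suc n) ≡ - ((1ℚ + double n) * v n)
v-recurrence n = ι-cancel (half-power n) {{half-power≢0 n}} (begin
  h * (double (suc n) * v (suc n))
    ≡⟨ ℚ.*-assoc h (double (suc n)) (v (suc n)) ⟨
  h * double (suc n) * v (suc n)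
    ≡⟨ cong (_* v (suc n)) (trans (cong (ι ∘ +_) (half-power-suc n)) (ι-ℕ* (half-power n) (2 ℕ.* suc n))) ⟨
  ι (+ half-power (suc n)) * v (suc n)
    ≡⟨ half-power*v (suc n) ⟩
  sign (suc n) * ι (+ odd‼ (suc n))
    ≡⟨ cong₂ _*_ (sign-suc n) (trans (ι-ℕ* (suc (2 ℕ.* n)) (odd‼ n)) (cong (_* ι (+ odd‼ n)) (ι-suc-2* n))) ⟩
  - sign n * ((1ℚ + double n) * ι (+ odd‼ n))
    ≡⟨ solve 3 (λ a b c → :- a :* (b :* c) := :- (b :* (a :* c))) refl (sign n) (1ℚ + double n) (ι (+ odd‼ n)) ⟩
  - ((1ℚ + double n) * (sign n * ι (+ odd‼ n)))
    ≡⟨ cong (λ x → - ((1ℚ + double n) * x)) (half-power*v n) ⟨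
  - ((1ℚ + double n) * (h * v n))
    ≡⟨ solve 3 (λ a b c → :- (b :* (a :* c)) := a :* :- (b :* c)) refl h (1ℚ + double n) (v n) ⟩
  h * - ((1ℚ + double n) * v n)
    ∎)
  where
  open ≡-Reasoning
  open ℚS using (solve; _:*_; :-_; _:=_)
  h = ι (+ half-power n)

inSquare-2* : ∀ a n → inSquare a (2 ℕ.* n) ≡ a n
inSquare-2* a zero    = refl
inSquare-2* a (suc n) = trans (cong (inSquare a) (ℕ.*-suc 2 n)) (inSquare-2* (a ∘ suc) n)

arc : PowerSeries
arc n = arcsinh/t (2 ℕ.* n)

-- Termwise (arcsinh t)′ = v: the factor 1 + 2n undoes the integration. The rest of the denominator
-- is 4ⁿ n!², the square of `half-power n`, hence the two cancellations.
θ-arc : ∀ n → (1ℚ + double n) * arc n ≡ v n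
θ-arc n = ι-cancel (half-power n) {{half-power≢0 n}} (ι-cancel (half-power n) {{half-power≢0 n}} (begin
  h * (h * ((1ℚ + double n) * arc n))
    ≡⟨ solve 3 (λ h d a → h :* (h :* (d :* a)) := h :* h :* d :* a) refl h (1ℚ + double n) (arc n) ⟩
  h * h * (1ℚ + double n) * arc n
    ≡⟨ cong₂ _*_ denominator (inSquare-2* _ n) ⟩
  ι (+ d) * _
    ≡⟨ d*[i/d] d {{d≢0}} (-1ℤ ℤ.^ n ℤ.* + ((2 ℕ.* n) !)) ⟩
  ι (-1ℤ ℤ.^ n ℤ.* + ((2 ℕ.* n) !))
    ≡⟨ ι-* (-1ℤ ℤ.^ n) (+ ((2 ℕ.* n) !)) ⟩
  sign n * ι (+ ((2 ℕ.* n) !))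
    ≡⟨ cong (sign n *_) (trans (cong (ι ∘ +_) (even! n)) (ι-ℕ* (half-power n) (odd‼ n))) ⟩
  sign n * (h * ι (+ odd‼ n))
    ≡⟨ solve 3 (λ a b c → a :* (b :* c) := b :* (a :* c)) refl (sign n) h (ι (+ odd‼ n)) ⟩
  h * (sign n * ι (+ odd‼ n))
    ≡⟨ cong (h *_) (half-power*v n) ⟨
  h * (h * v n)
    ∎))
  where
  open ≡-Reasoning
  open ℚS using (solve; _:*_; _:=_)
  h = ι (+ half-power n)
  d = 4 ℕ.^ n ℕ.* n ! ℕ.* n ! ℕ.* suc (2 ℕ.* n)
  d≢0 : NonZero d
  d≢0 = ℕ.m*n≢0 (4 ℕ.^ n ℕ.* n ! ℕ.* n !) (suc (2 ℕ.* n))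
    {{ℕ.m*n≢0 (4 ℕ.^ n ℕ.* n !) (n !) {{ℕ.m*n≢0 (4 ℕ.^ n) (n !) {{ℕ.m^n≢0 4 n}} {{n ℕ.!≢0}}}} {{n ℕ.!≢0}}}}
  4^n : 4 ℕ.^ n ≡ 2 ℕ.^ n ℕ.* 2 ℕ.^ n
  4^n = trans (ℕ.^-*-assoc 2 2 n) (trans (ℕ.^-distribˡ-+-* 2 n (n ℕ.+ 0))
    (cong (λ m → 2 ℕ.^ n ℕ.* 2 ℕ.^ m) (ℕ.+-identityʳ n)))
  regroup : ∀ a b c → a ℕ.* a ℕ.* b ℕ.* b ℕ.* c ≡ a ℕ.* b ℕ.* (a ℕ.* b) ℕ.* c
  regroup = ℕ-Ring.solve-∀
  denominator : h * h * (1ℚ + double n) ≡ ι (+ d)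
  denominator = sym (begin
    ι (+ d)
      ≡⟨ cong (λ m → ι (+ (m ℕ.* n ! ℕ.* n ! ℕ.* suc (2 ℕ.* n)))) 4^n ⟩
    ι (+ (2 ℕ.^ n ℕ.* 2 ℕ.^ n ℕ.* n ! ℕ.* n ! ℕ.* suc (2 ℕ.* n)))
      ≡⟨ cong (ι ∘ +_) (regroup (2 ℕ.^ n) (n !) (suc (2 ℕ.* n))) ⟩
    ι (+ (half-power n ℕ.* half-power n ℕ.* suc (2 ℕ.* n)))
      ≡⟨ trans (ι-ℕ* (half-power n ℕ.* half-power n) (suc (2 ℕ.* n)))
           (cong₂ _*_ (ι-ℕ* (half-power n) (half-power n)) (ι-suc-2* n)) ⟩
    h * h * (1ℚ + double n)
      ∎)

-- Two indices with an even sum have the same parity, and the odd pairs vanish with `f`. This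
-- carries products of series in t over to series in s.
⊛-even : ∀ f g → (∀ {n} → Odd n → f n ≡ 0ℚ) →
  ∀ n → (f ⊛ g) (2 ℕ.* n) ≡ ((λ i → f (2 ℕ.* i)) ⊛ (λ i → g (2 ℕ.* i))) n
⊛-even f g f-odd zero    = refl
⊛-even f g f-odd (suc n) = begin
  (f ⊛ g) (2 ℕ.* suc n)
    ≡⟨ cong (f ⊛ g) (ℕ.*-suc 2 n) ⟩
  f 0 * g (suc (suc (2 ℕ.* n))) + (f 1 * g (suc (2 ℕ.* n)) + ((λ i → f (suc (suc i))) ⊛ g) (2 ℕ.* n))
    ≡⟨ cong₂ (λ m x → f 0 * g m + x) (sym (ℕ.*-suc 2 n))
        (trans (cong (_+ ((λ i → f (suc (suc i))) ⊛ g) (2 ℕ.* n))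
            (trans (cong (_* g (suc (2 ℕ.* n))) (f-odd odd-1)) (ℚ.*-zeroˡ (g (suc (2 ℕ.* n))))))
          (ℚ.+-identityˡ _)) ⟩
  f 0 * g (2 ℕ.* suc n) + ((λ i → f (suc (suc i))) ⊛ g) (2 ℕ.* n)
    ≡⟨ cong (λ x → f 0 * g (2 ℕ.* suc n) + x) (trans (⊛-even (λ i → f (suc (suc i))) g (λ o → f-odd (odd-2+ o)) n)
        (⊛-cong {h = λ i → g (2 ℕ.* i)} (λ i → cong f (sym (ℕ.*-suc 2 i))) (λ _ → refl) n)) ⟩
  ((λ i → f (2 ℕ.* i)) ⊛ (λ i → g (2 ℕ.* i))) (suc n)
    ∎
  where open ≡-Reasoning

θ-isDerivation : IsDerivation seriesRing constant-hom θ
θ-isDerivation = record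
  { ∂-cong = λ f≗g n → cong (double n *_) (f≗g n)
  ; ∂-+ = λ f g n → ℚ.*-distribˡ-+ (double n) (f n) (g n)
  ; ∂-* = θ-⊛
  ; ∂-neg = λ f n → sym (ℚ.neg-distribʳ-* (double n) (f n))
  ; ∂-int = θ-constant
  }

open Derivation seriesRing constant-hom θ θ-isDerivation hiding (w)
open CommutativeRing seriesRing using () renaming (_-_ to _⊟_; -_ to ⊟_)

var-⊛ : ∀ f → var ⊛ f ≗ shift f
var-⊛ f zero    = shift-⊛ one f 0
var-⊛ f (suc n) = trans (shift-⊛ one f (suc n)) (one-⊛ f n)

one≗1 : one ≗ constant 1ℤ
one≗1 n = sym (ℚ.*-identityˡ (one n))

θ-var : θ var ≗ constant (+ 2) ⊛ var
θ-var n = trans (pointwise n) (sym (constant-⊛ (+ 2) var n))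
  where
  pointwise : ∀ n → θ var n ≡ ι (+ 2) * var n
  pointwise zero          = refl
  pointwise (suc zero)    = refl
  pointwise (suc (suc n)) = trans (ℚ.*-zeroʳ (double (suc (suc n)))) (sym (ℚ.*-zeroʳ (ι (+ 2))))

θ-v : θ v ⊕ (var ⊛ θ v) ≗ ⊟ (var ⊛ v)
θ-v zero    = refl
θ-v (suc n) = trans (cong (λ x → θ v (suc n) + x) (var-⊛ (θ v) (suc n)))
  (trans (trans (cong (_+ θ v n) (v-recurrence n))
    (solve 2 (λ d x → :- ((con 1ℤ :+ d) :* x) :+ d :* x := :- x) refl (double n) (v n)))
  (cong -_ (sym (var-⊛ v (suc n)))))
  where open ℚS

-- Characteristic zero: the eigenvalue 2n + 2 of θ is invertible.
θ-kernel : ∀ f → (∀ n → θ f n ≡ 0ℚ) → ∀ n → f (suc n) ≡ 0ℚ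
θ-kernel f θf≗0 n = ι-cancel (2 ℕ.* suc n) {x = f (suc n)} {y = 0ℚ}
  (trans (θf≗0 (suc n)) (sym (ℚ.*-zeroʳ (double (suc n)))))

-- (1 + t²)^(1/2)
w : PowerSeries
w = v ⊕ (var ⊛ v)

v-⊛-w : v ⊛ w ≗ constant 1ℤ
v-⊛-w zero    = refl
v-⊛-w (suc n) = θ-kernel (v ⊛ w) (∂[v*w]≈0 θ-var θ-v) n

G : PowerSeries
G n = t/arcsinh (2 ℕ.* n)

G-⊛-arc : G ⊛ arc ≗ constant 1ℤ
G-⊛-arc n = trans (⊛-comm G arc n) (trans (sym (⊛-even arcsinh/t t/arcsinh (inSquare-odd _) n))
  (trans (⊛-reciprocal arcsinh/t refl (2 ℕ.* n)) (trans (one-2* n) (one≗1 n))))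
  where
  one-2* : ∀ n → one (2 ℕ.* n) ≡ one n
  one-2* zero    = refl
  one-2* (suc n) = refl

θ-G : θ G ≗ G ⊟ (v ⊛ (G ⊛ G))
θ-G = inverse-derivative {G} {arc} {v} G-⊛-arc λ n → trans
  (solve 2 (λ a d → a :+ d :* a := (con 1ℤ :+ d) :* a) refl (arc n) (double n)) (θ-arc n)
  where open ℚS

-- Reading θ v = v³ - v backwards avoids the triple convolution. The factor 1 + 2n turns (2n-1)!!
-- into (2n+1)!!.
v³-coefficient : ∀ n → (v ⊛ v ⊛ v) n ≡ (1ℚ + double n) * v n
v³-coefficient n = trans
  (ℚS.solve 2 (λ a b → a ℚS.:= b ℚS.:+ (a ℚS.:- b)) refl ((v ⊛ v ⊛ v) n) (v n))
  (trans (cong (λ x → v n + x) (sym (∂v-cubic θ-var θ-v v-⊛-w n)))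
    (ℚS.solve 2 (λ a d → a ℚS.:+ d ℚS.:* a ℚS.:= (ℚS.con 1ℤ ℚS.:+ d) ℚS.:* a) refl (v n) (double n)))

identity : constant (+ 30) ⊛ (falling 2 G ⊛ falling 2 G) ≗
  ((⊟ ((falling 4 G ⊛ (constant (+ 5) ⊛ θ w)) ⊕ ((θ (falling 4 G) ⊕ falling 4 G) ⊛ w)))
   ⊟ (constant (+ 10) ⊛ (var ⊛ (((constant (+ 3) ⊛ θ (falling 2 G)) ⊟ (constant (+ 5) ⊛ falling 2 G)) ⊛ (v ⊛ v ⊛ v)))))
   ⊟ (var ⊛ (var ⊛ (cubic G ⊛ (v ⊛ v ⊛ v))))
identity = convolution-identity {G} {v} {var} {w} θ-G (∂v-cubic θ-var θ-v v-⊛-w) (∂w θ-var θ-v) v-⊛-w (svv θ-var θ-v v-⊛-w)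

open ≡-Reasoning

-- Coefficients of the identity

falling-coefficient : ∀ k f n → falling (suc k) f n ≡ (double n - ι (+ k)) * falling k f n
falling-coefficient k f n = trans
  (cong (λ x → double n * falling k f n - x) (constant-⊛ (+ k) (falling k f) n))
  (solve 3 (λ d k x → d :* x :- k :* x := (d :- k) :* x) refl (double n) (ι (+ k)) (falling k f n))
  where open ℚS

cubic-coefficient : ∀ f n → let d = double n in
  cubic f n ≡ (ι (+ 20) * (d * (d * d)) - ι (+ 55) * (d * d) + ι (+ 36) * d - 1ℚ) * f n
cubic-coefficient f n = trans
  (cong₂ (λ x y → x + y - f n)
    (cong₂ _-_ (constant-⊛ (+ 20) (θ (θ (θ f))) n) (constant-⊛ (+ 55) (θ (θ f)) n))
    (constant-⊛ (+ 36) (θ f) n))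
  (solve 2 (λ d x →
      con (+ 20) :* (d :* (d :* (d :* x))) :- con (+ 55) :* (d :* (d :* x)) :+ con (+ 36) :* (d :* x) :- x
      := (con (+ 20) :* (d :* (d :* d)) :- con (+ 55) :* (d :* d) :+ con (+ 36) :* d :- con 1ℤ) :* x)
    refl (double n) (f n))
  where open ℚS

⊛-tailˡ : ∀ f g n → f 0 ≡ 0ℚ → (f ⊛ g) (suc n) ≡ ((f ∘ suc) ⊛ g) n
⊛-tailˡ f g n f₀ = trans
  (cong (_+ ((f ∘ suc) ⊛ g) n) (trans (cong (_* g (suc n)) f₀) (ℚ.*-zeroˡ (g (suc n)))))
  (ℚ.+-identityˡ _)

⊛-tailʳ : ∀ f g n → g 0 ≡ 0ℚ → (f ⊛ g) (suc n) ≡ (f ⊛ (g ∘ suc)) n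
⊛-tailʳ f g n g₀ = trans (⊛-comm f g (suc n)) (trans (⊛-tailˡ g f n g₀) (⊛-comm (g ∘ suc) f n))

D₂ D₄ : PowerSeries
D₂ = falling 2 G
D₄ = falling 4 G

E₁ E₂ E₃ : PowerSeries
E₁ = θ D₄ ⊕ D₄
E₂ = (constant (+ 3) ⊛ θ D₂) ⊟ (constant (+ 5) ⊛ D₂)
E₃ = cubic G

D₂-coefficient : ∀ n → D₂ n ≡ (double n - 1ℚ) * (double n * G n)
D₂-coefficient n = trans (falling-coefficient 1 G n) (cong ((double n - 1ℚ) *_)
  (trans (falling-coefficient 0 G n) (cong (_* G n) (ℚ.+-identityʳ (double n)))))

D₄-coefficient : ∀ n → D₄ n ≡ (double n - ι (+ 3)) * ((double n - ι (+ 2)) * D₂ n)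
D₄-coefficient n = trans (falling-coefficient 3 G n)
  (cong ((double n - ι (+ 3)) *_) (falling-coefficient 2 G n))

E₂-coefficient : ∀ n → E₂ n ≡ (ι (+ 3) * double n - ι (+ 5)) * D₂ n
E₂-coefficient n = trans (cong₂ _-_ (constant-⊛ (+ 3) (θ D₂) n) (constant-⊛ (+ 5) D₂ n))
  (solve 2 (λ d x → con (+ 3) :* (d :* x) :- con (+ 5) :* x := (con (+ 3) :* d :- con (+ 5)) :* x)
    refl (double n) (D₂ n))
  where open ℚS

u : PowerSeries
u = v ⊛ v ⊛ v

5θw : PowerSeries
5θw = constant (+ 5) ⊛ θ w

-- Index n + 2 means t^(2n+4). D₂ and E₂ start at s, D₄ and E₁ at s², and the remaining shifts are
-- explicit factors `var`; so each convolution loses two indices and becomes a sum over l ≤ n.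
coefficient-identity : ∀ n →
  ι (+ 30) * ((D₂ ∘ suc) ⊛ (D₂ ∘ suc)) n ≡
    - ((((λ l → D₄ (suc (suc l))) ⊛ 5θw) n) + ((λ l → E₁ (suc (suc l))) ⊛ w) n)
    - ι (+ 10) * ((E₂ ∘ suc) ⊛ u) n
    - (E₃ ⊛ u) n
coefficient-identity n = begin
  ι (+ 30) * ((D₂ ∘ suc) ⊛ (D₂ ∘ suc)) n
    ≡⟨ cong (ι (+ 30) *_) (trans (⊛-tailˡ D₂ D₂ (suc n) refl) (⊛-tailʳ (D₂ ∘ suc) D₂ n refl)) ⟨
  ι (+ 30) * (D₂ ⊛ D₂) (suc (suc n))
    ≡⟨ constant-⊛ (+ 30) (D₂ ⊛ D₂) (suc (suc n)) ⟨
  (constant (+ 30) ⊛ (D₂ ⊛ D₂)) (suc (suc n))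
    ≡⟨ identity (suc (suc n)) ⟩
  _ ≡⟨ cong₂ _-_ (cong₂ _-_
         (cong -_ (cong₂ _+_ (drop₂ D₄ 5θw refl refl) (drop₂ E₁ w refl refl)))
         (trans (constant-⊛ (+ 10) (var ⊛ (E₂ ⊛ u)) (suc (suc n))) (cong (ι (+ 10) *_)
           (trans (var-⊛ (E₂ ⊛ u) (suc (suc n))) (⊛-tailˡ E₂ u n refl)))))
         (trans (var-⊛ (var ⊛ (E₃ ⊛ u)) (suc (suc n))) (var-⊛ (E₃ ⊛ u) (suc n))) ⟩
  - ((((λ l → D₄ (suc (suc l))) ⊛ 5θw) n) + ((λ l → E₁ (suc (suc l))) ⊛ w) n)
    - ι (+ 10) * ((E₂ ∘ suc) ⊛ u) n
    - (E₃ ⊛ u) n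
    ∎
  where
  drop₂ : ∀ f g → f 0 ≡ 0ℚ → f 1 ≡ 0ℚ → (f ⊛ g) (suc (suc n)) ≡ ((λ l → f (suc (suc l))) ⊛ g) n
  drop₂ f g f₀ f₁ = trans (⊛-tailˡ f g (suc n) f₀) (⊛-tailˡ (f ∘ suc) g n f₁)

-- Cauchy numbers as coefficients of D₂ and D₄

𝕮-D₂ : ∀ l → 𝕮 (2 ℕ.* l ℕ.+ 2) ≡ ι (+ ((2 ℕ.* l) !)) * D₂ (suc l)
𝕮-D₂ l = begin
  𝕮 (2 ℕ.* l ℕ.+ 2)
    ≡⟨ cong 𝕮 (ℕ.+-comm (2 ℕ.* l) 2) ⟩
  ι (+ (suc (suc (2 ℕ.* l)) ℕ.* (suc (2 ℕ.* l) ℕ.* (2 ℕ.* l) !))) * t/arcsinh (suc (suc (2 ℕ.* l)))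
    ≡⟨ cong₂ _*_
         (trans (ι-ℕ* (suc (suc (2 ℕ.* l))) (suc (2 ℕ.* l) ℕ.* (2 ℕ.* l) !))
           (cong₂ _*_ (ι-+ (+ 2) (+ (2 ℕ.* l)))
             (trans (ι-ℕ* (suc (2 ℕ.* l)) ((2 ℕ.* l) !)) (cong (_* f) (ι-suc-2* l)))))
         (cong t/arcsinh (sym (ℕ.*-suc 2 l))) ⟩
  (ι (+ 2) + double l) * ((1ℚ + double l) * f) * G (suc l)
    ≡⟨ solve 3 (λ d f g → (con (+ 2) :+ d) :* ((con 1ℤ :+ d) :* f) :* g
         := f :* ((con (+ 2) :+ d :- con 1ℤ) :* ((con (+ 2) :+ d) :* g))) refl (double l) f (G (suc l)) ⟩
  f * ((ι (+ 2) + double l - 1ℚ) * ((ι (+ 2) + double l) * G (suc l)))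
    ≡⟨ cong (λ d → f * ((d - 1ℚ) * (d * G (suc l)))) (double-suc l) ⟨
  f * ((double (suc l) - 1ℚ) * (double (suc l) * G (suc l)))
    ≡⟨ cong (f *_) (D₂-coefficient (suc l)) ⟨
  f * D₂ (suc l)
    ∎
  where
  open ℚS using (solve; con; _:+_; _:-_; _:*_; _:=_)
  f = ι (+ ((2 ℕ.* l) !))

𝕮-D₄ : ∀ l → 𝕮 (2 ℕ.* l ℕ.+ 4) ≡ ι (+ ((2 ℕ.* l) !)) * D₄ (suc (suc l))
𝕮-D₄ l = begin
  𝕮 (2 ℕ.* l ℕ.+ 4)
    ≡⟨ cong 𝕮 (trans (sym (ℕ.+-assoc (2 ℕ.* l) 2 2))
         (cong (ℕ._+ 2) (trans (ℕ.+-comm (2 ℕ.* l) 2) (sym (ℕ.*-suc 2 l))))) ⟩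
  𝕮 (2 ℕ.* suc l ℕ.+ 2)
    ≡⟨ 𝕮-D₂ (suc l) ⟩
  ι (+ ((2 ℕ.* suc l) !)) * x
    ≡⟨ cong (_* x) (trans (cong (λ m → ι (+ (m !))) (ℕ.*-suc 2 l))
         (trans (ι-ℕ* (suc (suc (2 ℕ.* l))) (suc (2 ℕ.* l) ℕ.* (2 ℕ.* l) !))
           (cong₂ _*_ (ι-+ (+ 2) (+ (2 ℕ.* l)))
             (trans (ι-ℕ* (suc (2 ℕ.* l)) ((2 ℕ.* l) !)) (cong (_* f) (ι-suc-2* l)))))) ⟩
  (ι (+ 2) + double l) * ((1ℚ + double l) * f) * x
    ≡⟨ solve 3 (λ d f x → (con (+ 2) :+ d) :* ((con 1ℤ :+ d) :* f) :* x
         := f :* ((con (+ 2) :+ (con (+ 2) :+ d) :- con (+ 3)) :* ((con (+ 2) :+ (con (+ 2) :+ d) :- con (+ 2)) :* x)))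
         refl (double l) f x ⟩
  f * ((ι (+ 2) + (ι (+ 2) + double l) - ι (+ 3)) * ((ι (+ 2) + (ι (+ 2) + double l) - ι (+ 2)) * x))
    ≡⟨ cong (λ d → f * ((d - ι (+ 3)) * ((d - ι (+ 2)) * x)))
         (trans (double-suc (suc l)) (cong (λ d → ι (+ 2) + d) (double-suc l))) ⟨
  f * ((double (suc (suc l)) - ι (+ 3)) * ((double (suc (suc l)) - ι (+ 2)) * x))
    ≡⟨ cong (f *_) (D₄-coefficient (suc (suc l))) ⟨
  f * D₄ (suc (suc l))
    ∎
  where
  open ℚS using (solve; con; _:+_; _:-_; _:*_; _:=_)
  f = ι (+ ((2 ℕ.* l) !))
  x = D₂ (suc (suc l))

-- Double factorials as coefficients of v³ and w

weight-sign : ∀ n l → ι (+ half-power (n ∸ l)) * (ι (+ ((2 ℕ.* l) !)) * weight n l) ≡ sign (n ∸ l)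
weight-sign n l = begin
  ι (+ half-power (n ∸ l)) * (ι (+ ((2 ℕ.* l) !)) * weight n l)
    ≡⟨ ℚ.*-assoc (ι (+ half-power (n ∸ l))) (ι (+ ((2 ℕ.* l) !))) (weight n l) ⟨
  ι (+ half-power (n ∸ l)) * ι (+ ((2 ℕ.* l) !)) * weight n l
    ≡⟨ cong (_* weight n l) (ι-ℕ* (half-power (n ∸ l)) ((2 ℕ.* l) !)) ⟨
  ι (+ (half-power (n ∸ l) ℕ.* (2 ℕ.* l) !)) * weight n l
    ≡⟨ d*[i/d] (half-power (n ∸ l) ℕ.* (2 ℕ.* l) !)
         {{ℕ.m*n≢0 (half-power (n ∸ l)) ((2 ℕ.* l) !) {{half-power≢0 (n ∸ l)}} {{(2 ℕ.* l) ℕ.!≢0}}}} (-1ℤ ℤ.^ (n ∸ l)) ⟩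
  sign (n ∸ l)
    ∎

-- The hypothesis describes x = (-1)^k / (2^k k!) without a division; `weight-sign` provides it for
-- x = (2l)! `weight n l` with k = n - l.
u-coefficient : ∀ k {x} → ι (+ half-power k) * x ≡ sign k → x * [2 + k ℤ.+ 1ℤ -1]‼ ≡ u k
u-coefficient k {x} hx = ι-cancel (half-power k) {{half-power≢0 k}} (begin
  h * (x * ι (+ odd‼ (k ℕ.+ 1)))
    ≡⟨ ℚ.*-assoc h x (ι (+ odd‼ (k ℕ.+ 1))) ⟨
  h * x * ι (+ odd‼ (k ℕ.+ 1))
    ≡⟨ cong₂ _*_ hx (trans (cong (λ m → ι (+ odd‼ m)) (ℕ.+-comm k 1))
         (trans (ι-ℕ* (suc (2 ℕ.* k)) (odd‼ k)) (cong (_* ι (+ odd‼ k)) (ι-suc-2* k)))) ⟩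
  sign k * ((1ℚ + double k) * ι (+ odd‼ k))
    ≡⟨ swap (sign k) (1ℚ + double k) (ι (+ odd‼ k)) ⟩
  (1ℚ + double k) * (sign k * ι (+ odd‼ k))
    ≡⟨ cong ((1ℚ + double k) *_) (half-power*v k) ⟨
  (1ℚ + double k) * (h * v k)
    ≡⟨ swap (1ℚ + double k) h (v k) ⟩
  h * ((1ℚ + double k) * v k)
    ≡⟨ cong (h *_) (v³-coefficient k) ⟨
  h * u k
    ∎)
  where
  h = ι (+ half-power k)
  swap : ∀ a b c → a * (b * c) ≡ b * (a * c)
  swap a b c = solve 3 (λ a b c → a :* (b :* c) := b :* (a :* c)) refl a b c
    where open ℚS

w-coefficient : ∀ k {x} → ι (+ half-power k) * x ≡ sign k → x * [2 + k ℤ.- 1ℤ -1]‼ ≡ - w k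
-- The double factorial is (-3)!! = -1 here, by the convention for negative arguments, and so agrees
-- with the constant term 1 of `w`.
w-coefficient zero    {x} hx = cong (_* (- 1ℚ)) (trans (sym (ℚ.*-identityˡ x)) hx)
w-coefficient (suc j) {x} hx = ι-cancel (half-power (suc j)) {{half-power≢0 (suc j)}} (begin
  ι (+ half-power (suc j)) * (x * ι (+ odd‼ j))
    ≡⟨ ℚ.*-assoc (ι (+ half-power (suc j))) x (ι (+ odd‼ j)) ⟨
  ι (+ half-power (suc j)) * x * ι (+ odd‼ j)
    ≡⟨ cong (_* ι (+ odd‼ j)) (trans hx (sign-suc j)) ⟩
  - sign j * ι (+ odd‼ j)
    ≡⟨ trans (sym (ℚ.neg-distribˡ-* (sign j) (ι (+ odd‼ j)))) (cong -_ (sym (half-power*v j))) ⟩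
  - (h * v j)
    -- Writing 1 as -(1 + 2j) + (2 + 2j) prepares the recurrence: v_j = (2j + 2)(v_(j+1) + v_j), and
    -- the bracket is the coefficient of (1 + s) v.
    ≡⟨ solve 3 (λ h d y → :- (h :* y) := :- (h :* (:- ((con 1ℤ :+ d) :* y) :+ (con (+ 2) :+ d) :* y)))
         refl h (double j) (v j) ⟩
  - (h * (- ((1ℚ + double j) * v j) + (ι (+ 2) + double j) * v j))
    ≡⟨ cong₂ (λ a b → - (h * (a + b * v j))) (v-recurrence j) (double-suc j) ⟨
  - (h * (double (suc j) * v (suc j) + double (suc j) * v j))
    ≡⟨ solve 4 (λ h d a b → :- (h :* (d :* a :+ d :* b)) := h :* d :* :- (a :+ b))
         refl h (double (suc j)) (v (suc j)) (v j) ⟩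
  h * double (suc j) * - (v (suc j) + v j)
    ≡⟨ cong₂ (λ a b → a * - (v (suc j) + b))
         (trans (cong (ι ∘ +_) (half-power-suc j)) (ι-ℕ* (half-power j) (2 ℕ.* suc j)))
         (var-⊛ v (suc j)) ⟨
  ι (+ half-power (suc j)) * - w (suc j)
    ∎)
  where
  open ℚS using (solve; con; _:+_; _:-_; _:*_; :-_; _:=_)
  h = ι (+ half-power j)

-- The polynomial factors as eigenvalues of operators in θ

ι-minus : ∀ i j → ι (i ℤ.- j) ≡ ι i - ι j
ι-minus i j = trans (ι-+ i (ℤ.- j)) (cong (λ x → ι i + x) (ι-neg j))

-- k stands for n - l.
linear₁ : ∀ k l → ι (+ 10 ℤ.* + (k ℕ.+ l) ℤ.- + 8 ℤ.* + l ℤ.+ + 5)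
  ≡ ι (+ 5) * double k + (1ℚ + double (suc (suc l)))
linear₁ k l = begin
  ι (+ 10 ℤ.* + (k ℕ.+ l) ℤ.- + 8 ℤ.* + l ℤ.+ + 5)
    ≡⟨ trans (ι-+ (+ 10 ℤ.* + (k ℕ.+ l) ℤ.- + 8 ℤ.* + l) (+ 5)) (cong (_+ ι (+ 5))
         (trans (ι-minus (+ 10 ℤ.* + (k ℕ.+ l)) (+ 8 ℤ.* + l)) (cong₂ _-_
           (trans (ι-* (+ 10) (+ (k ℕ.+ l))) (cong (ι (+ 10) *_) (ι-+ (+ k) (+ l))))
           (ι-* (+ 8) (+ l))))) ⟩
  ι (+ 10) * (ι (+ k) + ι (+ l)) - ι (+ 8) * ι (+ l) + ι (+ 5)
    ≡⟨ solve 2 (λ k l → con (+ 10) :* (k :+ l) :- con (+ 8) :* l :+ con (+ 5)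
         := con (+ 5) :* (con (+ 2) :* k) :+ (con 1ℤ :+ (con (+ 2) :+ (con (+ 2) :+ con (+ 2) :* l))))
         refl (ι (+ k)) (ι (+ l)) ⟩
  ι (+ 5) * (ι (+ 2) * ι (+ k)) + (1ℚ + (ι (+ 2) + (ι (+ 2) + ι (+ 2) * ι (+ l))))
    ≡⟨ cong₂ (λ x y → ι (+ 5) * x + (1ℚ + y)) (ι-ℕ* 2 k)
         (trans (double-suc (suc l)) (cong (λ d → ι (+ 2) + d) (trans (double-suc l)
           (cong (λ d → ι (+ 2) + d) (ι-ℕ* 2 l))))) ⟨
  ι (+ 5) * double k + (1ℚ + double (suc (suc l)))
    ∎
  where open ℚS using (solve; con; _:+_; _:-_; _:*_; _:=_)

linear₂ : ∀ l → ι (+ 6 ℤ.* + l ℤ.+ + 1) ≡ ι (+ 3) * double (suc l) - ι (+ 5)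
linear₂ l = begin
  ι (+ 6 ℤ.* + l ℤ.+ + 1)
    ≡⟨ trans (ι-+ (+ 6 ℤ.* + l) (+ 1)) (cong (_+ 1ℚ) (ι-* (+ 6) (+ l))) ⟩
  ι (+ 6) * ι (+ l) + 1ℚ
    ≡⟨ solve 1 (λ l → con (+ 6) :* l :+ con 1ℤ := con (+ 3) :* (con (+ 2) :+ con (+ 2) :* l) :- con (+ 5))
         refl (ι (+ l)) ⟩
  ι (+ 3) * (ι (+ 2) + ι (+ 2) * ι (+ l)) - ι (+ 5)
    ≡⟨ cong (λ d → ι (+ 3) * d - ι (+ 5)) (trans (double-suc l) (cong (λ d → ι (+ 2) + d) (ι-ℕ* 2 l))) ⟨
  ι (+ 3) * double (suc l) - ι (+ 5)
    ∎
  where open ℚS using (solve; con; _:+_; _:-_; _:*_; _:=_)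

cubic₃ : ∀ l → let d = double l in
  ι (+ 160 ℤ.* (+ l) ℤ.^ 3 ℤ.- + 220 ℤ.* (+ l) ℤ.^ 2 ℤ.+ + 72 ℤ.* + l ℤ.- + 1)
  ≡ ι (+ 20) * (d * (d * d)) - ι (+ 55) * (d * d) + ι (+ 36) * d - 1ℚ
cubic₃ l = begin
  ι (+ 160 ℤ.* i ℤ.^ 3 ℤ.- + 220 ℤ.* i ℤ.^ 2 ℤ.+ + 72 ℤ.* i ℤ.- + 1)
    ≡⟨ trans (ι-minus (+ 160 ℤ.* i ℤ.^ 3 ℤ.- + 220 ℤ.* i ℤ.^ 2 ℤ.+ + 72 ℤ.* i) (+ 1)) (cong (_- 1ℚ)
         (trans (ι-+ (+ 160 ℤ.* i ℤ.^ 3 ℤ.- + 220 ℤ.* i ℤ.^ 2) (+ 72 ℤ.* i)) (cong₂ _+_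
           (trans (ι-minus (+ 160 ℤ.* i ℤ.^ 3) (+ 220 ℤ.* i ℤ.^ 2)) (cong₂ _-_
             (trans (ι-* (+ 160) (i ℤ.^ 3)) (cong (ι (+ 160) *_) (ι-^-suc 2 (ι-^-suc 1 (ι-^-suc 0 refl)))))
             (trans (ι-* (+ 220) (i ℤ.^ 2)) (cong (ι (+ 220) *_) (ι-^-suc 1 (ι-^-suc 0 refl))))))
           (ι-* (+ 72) i)))) ⟩
  ι (+ 160) * (x * (x * (x * 1ℚ))) - ι (+ 220) * (x * (x * 1ℚ)) + ι (+ 72) * x - 1ℚ
    ≡⟨ solve 1 (λ x →
           con (+ 160) :* (x :* (x :* (x :* con 1ℤ))) :- con (+ 220) :* (x :* (x :* con 1ℤ)) :+ con (+ 72) :* x :- con 1ℤ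
           := con (+ 20) :* (con (+ 2) :* x :* (con (+ 2) :* x :* (con (+ 2) :* x)))
             :- con (+ 55) :* (con (+ 2) :* x :* (con (+ 2) :* x)) :+ con (+ 36) :* (con (+ 2) :* x) :- con 1ℤ)
         refl x ⟩
  _ ≡⟨ cong (λ d → ι (+ 20) * (d * (d * d)) - ι (+ 55) * (d * d) + ι (+ 36) * d - 1ℚ) (ι-ℕ* 2 l) ⟨
  _ ∎
  where
  open ℚS using (solve; con; _:+_; _:-_; _:*_; _:=_)
  i = + l
  x = ι (+ l)
  ι-^-suc : ∀ k {y} → ι (i ℤ.^ k) ≡ y → ι (i ℤ.^ suc k) ≡ x * y
  ι-^-suc k eq = trans (ι-* i (i ℤ.^ k)) (cong (x *_) eq)

-- The summands of the theorem as products of coefficients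

collect-weight : ∀ a b c f x → a * b * c * (f * x) ≡ f * a * c * (b * x)
collect-weight a b c f x = solve 5 (λ a b c f x → a :* b :* c :* (f :* x) := f :* a :* c :* (b :* x)) refl a b c f x
  where open ℚS

-- The factor is 5 · 2(n - l) + (2l + 4) + 1: the first part is 5 θ acting on `w` at index n - l,
-- the rest is θ + 1 acting on `D₄` at index l + 2. This is how the dependence on n produces a
-- derivative of `w`.
term₁ : ∀ n l → l ℕ.≤ n →
  weight n l * ι (+ 10 ℤ.* + n ℤ.- + 8 ℤ.* + l ℤ.+ + 5) * [2 + (n ∸ l) ℤ.- 1ℤ -1]‼ * 𝕮 (2 ℕ.* l ℕ.+ 4)
  ≡ - 1ℚ * (D₄ (suc (suc l)) * 5θw (n ∸ l) + E₁ (suc (suc l)) * w (n ∸ l))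
term₁ n l l≤n = begin
  weight n l * ι (+ 10 ℤ.* + n ℤ.- + 8 ℤ.* + l ℤ.+ + 5) * o * 𝕮 (2 ℕ.* l ℕ.+ 4)
    ≡⟨ cong₂ (λ a b → weight n l * a * o * b)
         (trans (cong (λ m → ι (+ 10 ℤ.* + m ℤ.- + 8 ℤ.* + l ℤ.+ + 5)) (sym (ℕ.m∸n+n≡m l≤n))) (linear₁ (n ∸ l) l))
         (𝕮-D₄ l) ⟩
  weight n l * (ι (+ 5) * d + (1ℚ + e)) * o * (f * x)
    ≡⟨ collect-weight (weight n l) (ι (+ 5) * d + (1ℚ + e)) o f x ⟩
  f * weight n l * o * ((ι (+ 5) * d + (1ℚ + e)) * x)
    ≡⟨ cong (_* ((ι (+ 5) * d + (1ℚ + e)) * x)) (w-coefficient (n ∸ l) (weight-sign n l)) ⟩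
  - w (n ∸ l) * ((ι (+ 5) * d + (1ℚ + e)) * x)
    ≡⟨ solve 4 (λ w d e x → :- w :* ((con (+ 5) :* d :+ (con 1ℤ :+ e)) :* x)
         := con -1ℤ :* (x :* (con (+ 5) :* (d :* w)) :+ (e :* x :+ x) :* w)) refl (w (n ∸ l)) d e x ⟩
  - 1ℚ * (x * (ι (+ 5) * (d * w (n ∸ l))) + (e * x + x) * w (n ∸ l))
    ≡⟨ cong (λ y → - 1ℚ * (x * y + E₁ (suc (suc l)) * w (n ∸ l))) (constant-⊛ (+ 5) (θ w) (n ∸ l)) ⟨
  - 1ℚ * (x * 5θw (n ∸ l) + E₁ (suc (suc l)) * w (n ∸ l))
    ∎
  where
  open ℚS using (solve; con; _:+_; _:-_; _:*_; :-_; _:=_)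
  o = [2 + (n ∸ l) ℤ.- 1ℤ -1]‼
  d = double (n ∸ l)
  e = double (suc (suc l))
  f = ι (+ ((2 ℕ.* l) !))
  x = D₄ (suc (suc l))

-- As `D₂` is read at index l + 1, the factor is 6l + 1 = 3 (2l + 2) - 5, the eigenvalue of 3 θ - 5.
term₂ : ∀ n l →
  weight n l * ι (+ 6 ℤ.* + l ℤ.+ + 1) * [2 + (n ∸ l) ℤ.+ 1ℤ -1]‼ * 𝕮 (2 ℕ.* l ℕ.+ 2)
  ≡ E₂ (suc l) * u (n ∸ l)
term₂ n l = begin
  weight n l * ι (+ 6 ℤ.* + l ℤ.+ + 1) * o * 𝕮 (2 ℕ.* l ℕ.+ 2)
    ≡⟨ cong₂ (λ a b → weight n l * a * o * b) (linear₂ l) (𝕮-D₂ l) ⟩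
  weight n l * p * o * (f * D₂ (suc l))
    ≡⟨ collect-weight (weight n l) p o f (D₂ (suc l)) ⟩
  f * weight n l * o * (p * D₂ (suc l))
    ≡⟨ cong₂ _*_ (u-coefficient (n ∸ l) (weight-sign n l)) (sym (E₂-coefficient (suc l))) ⟩
  u (n ∸ l) * E₂ (suc l)
    ≡⟨ ℚ.*-comm (u (n ∸ l)) (E₂ (suc l)) ⟩
  E₂ (suc l) * u (n ∸ l)
    ∎
  where
  o = [2 + (n ∸ l) ℤ.+ 1ℤ -1]‼
  f = ι (+ ((2 ℕ.* l) !))
  p = ι (+ 3) * double (suc l) - ι (+ 5)

term₃ : ∀ n l →
  weight n l * ι (+ 160 ℤ.* (+ l) ℤ.^ 3 ℤ.- + 220 ℤ.* (+ l) ℤ.^ 2 ℤ.+ + 72 ℤ.* + l ℤ.- + 1)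
    * [2 + (n ∸ l) ℤ.+ 1ℤ -1]‼ * 𝕮 (2 ℕ.* l)
  ≡ E₃ l * u (n ∸ l)
term₃ n l = begin
  weight n l * p * o * (f * G l)
    ≡⟨ collect-weight (weight n l) p o f (G l) ⟩
  f * weight n l * o * (p * G l)
    ≡⟨ cong₂ _*_ (u-coefficient (n ∸ l) (weight-sign n l))
         (trans (cong (_* G l) (cubic₃ l)) (sym (cubic-coefficient G l))) ⟩
  u (n ∸ l) * E₃ l
    ≡⟨ ℚ.*-comm (u (n ∸ l)) (E₃ l) ⟩
  E₃ l * u (n ∸ l)
    ∎
  where
  o = [2 + (n ∸ l) ℤ.+ 1ℤ -1]‼
  f = ι (+ ((2 ℕ.* l) !))
  p = ι (+ 160 ℤ.* (+ l) ℤ.^ 3 ℤ.- + 220 ℤ.* (+ l) ℤ.^ 2 ℤ.+ + 72 ℤ.* + l ℤ.- + 1)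

-- The convolution and the conclusion

convolution : ∀ n → [𝕮₂ 1 +𝕮₂ 1 ]^ n ≡ ι (+ ((2 ℕ.* n) !)) * ((D₂ ∘ suc) ⊛ (D₂ ∘ suc)) n
convolution n = trans
  (sum-cong-≗ {suc n} (λ i → term (toℕ i)))
  (sym (*-distribˡ-sum {suc n} (ι (+ ((2 ℕ.* n) !))) (λ i → D₂ (suc (toℕ i)) * D₂ (suc (n ∸ toℕ i)))))
  where
  term : ∀ i → _/_ (+ ((2 ℕ.* n) !)) ((2 ℕ.* i) ! ℕ.* (2 ℕ.* (n ∸ i)) !) {{(2 ℕ.* i) ℕ.!* (2 ℕ.* (n ∸ i)) !≢0}}
    * 𝕮 (2 ℕ.* i ℕ.+ 2) * 𝕮 (2 ℕ.* (n ∸ i) ℕ.+ 2) ≡ ι (+ ((2 ℕ.* n) !)) * (D₂ (suc i) * D₂ (suc (n ∸ i)))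
  term i = begin
    q * 𝕮 (2 ℕ.* i ℕ.+ 2) * 𝕮 (2 ℕ.* (n ∸ i) ℕ.+ 2)
      ≡⟨ cong₂ (λ x y → q * x * y) (𝕮-D₂ i) (𝕮-D₂ (n ∸ i)) ⟩
    q * (a * x) * (b * y)
      ≡⟨ solve 5 (λ q a b x y → q :* (a :* x) :* (b :* y) := a :* b :* q :* (x :* y)) refl q a b x y ⟩
    a * b * q * (x * y)
      ≡⟨ cong (_* (x * y)) (trans
           (cong (_* q) (sym (ι-ℕ* ((2 ℕ.* i) !) ((2 ℕ.* (n ∸ i)) !))))
           (d*[i/d] ((2 ℕ.* i) ! ℕ.* (2 ℕ.* (n ∸ i)) !) {{≢0}} (+ ((2 ℕ.* n) !)))) ⟩
    ι (+ ((2 ℕ.* n) !)) * (x * y)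
      ∎
    where
    open ℚS using (solve; _:*_; _:=_)
    ≢0 = (2 ℕ.* i) ℕ.!* (2 ℕ.* (n ∸ i)) !≢0
    q = _/_ (+ ((2 ℕ.* n) !)) ((2 ℕ.* i) ! ℕ.* (2 ℕ.* (n ∸ i)) !) {{≢0}}
    a = ι (+ ((2 ℕ.* i) !))
    b = ι (+ ((2 ℕ.* (n ∸ i)) !))
    x = D₂ (suc i)
    y = D₂ (suc (n ∸ i))

theorem4 : ∀ (n : ℕ) →
    [𝕮₂ 1 +𝕮₂ 1 ]^ n ≡
    (+ ((2 ℕ.* n) !) / 30)
    * (∑[ l ≤ n ]
    ( weight n l
    * ((+ 10 ℤ.* + n ℤ.- + 8 ℤ.* + l ℤ.+ + 5) / 1)
    * [2 + (n ∸ l) ℤ.- 1ℤ -1]‼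
    * 𝕮 (2 ℕ.* l ℕ.+ 4) ))
    - (+ ((2 ℕ.* n) !) / 3)
    * (∑[ l ≤ n ]
    ( weight n l
    * ((+ 6 ℤ.* + l ℤ.+ + 1) / 1)
    * [2 + (n ∸ l) ℤ.+ 1ℤ -1]‼
    * 𝕮 (2 ℕ.* l ℕ.+ 2) ))
    - (+ ((2 ℕ.* n) !) / 30)
    * (∑[ l ≤ n ]
    ( weight n l
    * ((+ 160 ℤ.* (+ l) ℤ.^ 3 ℤ.- + 220 ℤ.* (+ l) ℤ.^ 2 ℤ.+ + 72 ℤ.* + l ℤ.- + 1) / 1)
    * [2 + (n ∸ l) ℤ.+ 1ℤ -1]‼
    * 𝕮 (2 ℕ.* l) ))
theorem4 n = trans (convolution n) (ι-cancel 30 (begin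
  ι (+ 30) * (N * s₀)
    ≡⟨ solve 3 (λ a b c → a :* (b :* c) := b :* (a :* c)) refl (ι (+ 30)) N s₀ ⟩
  N * (ι (+ 30) * s₀)
    ≡⟨ cong (N *_) (coefficient-identity n) ⟩
  N * (- s₁ - ι (+ 10) * s₂ - s₃)
    ≡⟨ solve 4 (λ N a b c → N :* (:- a :- con (+ 10) :* b :- c)
         := N :* (con -1ℤ :* a) :- con (+ 10) :* N :* b :- N :* c) refl N s₁ s₂ s₃ ⟩
  N * (- 1ℚ * s₁) - ι (+ 10) * N * s₂ - N * s₃
    -- (2n)! is written as 30 · (2n)!/30 in the outer terms and as 3 · (2n)!/3 in the middle one,
    -- where 10 · 3 restores the common factor 30.
    ≡⟨ cong₂ (λ x y → x * (- 1ℚ * s₁) - ι (+ 10) * y * s₂ - x * s₃)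
         (d*[i/d] 30 (+ ((2 ℕ.* n) !))) (d*[i/d] 3 (+ ((2 ℕ.* n) !))) ⟨
  ι (+ 30) * N/30 * (- 1ℚ * s₁) - ι (+ 10) * (ι (+ 3) * N/3) * s₂ - ι (+ 30) * N/30 * s₃
    ≡⟨ solve 5 (λ x y a b c →
           con (+ 30) :* x :* a :- con (+ 10) :* (con (+ 3) :* y) :* b :- con (+ 30) :* x :* c
           := con (+ 30) :* (x :* a :- y :* b :- x :* c))
         refl N/30 N/3 (- 1ℚ * s₁) s₂ s₃ ⟩
  ι (+ 30) * (N/30 * (- 1ℚ * s₁) - N/3 * s₂ - N/30 * s₃)
    ≡⟨ cong (ι (+ 30) *_) (cong₂ _-_ (cong₂ (λ x y → N/30 * x - N/3 * y)
         sum₁ (sum-cong-≗ {suc n} (λ l → term₂ n (toℕ l))))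
         (cong (N/30 *_) (sum-cong-≗ {suc n} (λ l → term₃ n (toℕ l))))) ⟨
  _ ∎))
  where
  open ℚS using (solve; con; _:+_; _:-_; _:*_; :-_; _:=_)
  N = ι (+ ((2 ℕ.* n) !))
  N/30 = + ((2 ℕ.* n) !) / 30
  N/3 = + ((2 ℕ.* n) !) / 3
  s₀ = ((D₂ ∘ suc) ⊛ (D₂ ∘ suc)) n
  s₁ = ((λ l → D₄ (suc (suc l))) ⊛ 5θw) n + ((λ l → E₁ (suc (suc l))) ⊛ w) n
  s₂ = ((E₂ ∘ suc) ⊛ u) n
  s₃ = (E₃ ⊛ u) n
  a b : ℕ → ℚ
  a l = D₄ (suc (suc l)) * 5θw (n ∸ l)
  b l = E₁ (suc (suc l)) * w (n ∸ l)
  sum₁ : sumTo n (λ l → weight n l * ι (+ 10 ℤ.* + n ℤ.- + 8 ℤ.* + l ℤ.+ + 5)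
    * [2 + (n ∸ l) ℤ.- 1ℤ -1]‼ * 𝕮 (2 ℕ.* l ℕ.+ 4)) ≡ - 1ℚ * s₁
  sum₁ = trans
    (sum-cong-≗ {suc n} (λ l → term₁ n (toℕ l) (ℕ.s≤s⁻¹ (toℕ<n l))))
    (trans (sym (*-distribˡ-sum {suc n} (- 1ℚ) (λ l → a (toℕ l) + b (toℕ l))))
      (cong (- 1ℚ *_) (∑-distrib-+ {suc n} (λ l → a (toℕ l)) (λ l → b (toℕ l)))))
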